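{- There is an absolute constant $\beta>0$ such that for every integer $k>5$ there exists a $k$-terminal network $(G,c)$ with $G$ planar such that every mimicking network $(G',c')$ of $(G,c)$ satisfies $|E(G')|\ge \beta k^2$.
   Context: A network $(G,c)$ is an undirected graph $G$ with edge costs $c:E(G)\to\mathbb{R}^+$. A $k$-terminal network additionally has a set $Q=\{q_1,\dots,q_k\}\subseteq V(G)$ of distinguished vertices called terminals. For $S\subset Q$ with $S\neq\emptyset,Q$, write $\bar S=Q\setminus S$; a cut $(W,V(G)\setminus W)$ is $S$-separating if $W\cap Q\in\{S,\bar S\}$. The cost of a cut is the total cost of the edges with exactly one endpoint in $W$ (the cutset). $\mathrm{mincut}_{G,c}(S,\bar S)$ denotes the minimum cost of an $S$-separating cut. A mimicking network of a $k$-terminal network $(G,c)$ is a $k$-terminal network $(G',c')$ with the same terminal set $Q$ such that $\mathrm{mincut}_{G',c'}(S,\bar S)=\mathrm{mincut}_{G,c}(S,\bar S)$ for every $S\subset Q$ with $S\neq\emptyset,Q$. -}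

module Defs where

open import Algebra.Bundles.Raw using (RawMonoid)
import Algebra.Definitions.RawMonoid as MonoidOps
open import Data.Bool.Base using (if_then_else_; _xor_)
open import Data.Fin.Base as Fin using (Fin)
open import Data.Fin.Subset using (Subset; _∈_; ∁; ⊥; ⊤)
open import Data.Integer.Base using (+_)
open import Data.Nat.Base as ℕ using (ℕ; _⊔_)
import Data.Nat.Properties as ℕₚ
open import Data.Product using (Σ; ∃; ∃-syntax; _×_; _,_; proj₁; proj₂)
open import Data.Rational.Base as ℚ using (ℚ; 0ℚ; 1ℚ; ½; ∣_∣)
import Data.Rational.Properties as ℚₚ
open import Data.Rational.Solver using (module +-*-Solver)
open import Data.Sum.Base using (_⊎_)
open import Data.Vec.Base using (lookup)
open import Function.Bundles using (_⇔_)
open import Function.Definitions using (Injective)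
open import Level using (0ℓ)
open import Relation.Binary.Core using (Rel)
open import Relation.Binary.PropositionalEquality using (_≡_; _≢_; refl; sym; subst; subst₂)
open import Relation.Nullary using (¬_)

------------------------------------------------------------------------
-- Real numbers: Cauchy sequences of rationals, compared up to _≈_

IsCauchy : (ℕ → ℚ) → Set
IsCauchy f = ∀ (ε : ℚ) → 0ℚ ℚ.< ε →
  ∃[ N ] (∀ m n → N ℕ.≤ m → N ℕ.≤ n → ∣ f m ℚ.- f n ∣ ℚ.< ε)

record ℝ : Set where
  constructor mkℝ
  field
    seq    : ℕ → ℚ
    cauchy : IsCauchy seq

open ℝ public

infix 4 _≈_ _≤_ _<_

_≈_ _≤_ _<_ : Rel ℝ 0ℓ
x ≈ y = ∀ (ε : ℚ) → 0ℚ ℚ.< ε →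
  ∃[ N ] (∀ n → N ℕ.≤ n → ∣ seq x n ℚ.- seq y n ∣ ℚ.< ε)
x ≤ y = ∀ (ε : ℚ) → 0ℚ ℚ.< ε →
  ∃[ N ] (∀ n → N ℕ.≤ n → seq x n ℚ.≤ seq y n ℚ.+ ε)
x < y = ∃[ ε ] 0ℚ ℚ.< ε ×
  ∃[ N ] (∀ n → N ℕ.≤ n → seq x n ℚ.+ ε ℚ.≤ seq y n)

fromℚ : ℚ → ℝ
fromℚ q = mkℝ (λ _ → q) λ ε ε>0 →
  0 , λ _ _ _ _ → subst (λ z → ∣ z ∣ ℚ.< ε) (sym (ℚₚ.+-inverseʳ q)) ε>0

fromℕ : ℕ → ℝ
fromℕ n = fromℚ (+ n ℚ./ 1)

0ℝ 1ℝ : ℝ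
0ℝ = fromℚ 0ℚ
1ℝ = fromℚ 1ℚ

+-cauchy : ∀ f g → IsCauchy f → IsCauchy g → IsCauchy (λ n → f n ℚ.+ g n)
+-cauchy f g cf cg ε ε>0 = M ⊔ N , λ m n hm hn →
  ℚₚ.≤-<-trans
    (subst (λ z → ∣ z ∣ ℚ.≤ ∣ f m ℚ.- f n ∣ ℚ.+ ∣ g m ℚ.- g n ∣)
           (sym (regroup (f m) (g m) (f n) (g n)))
           (ℚₚ.∣p+q∣≤∣p∣+∣q∣ (f m ℚ.- f n) (g m ℚ.- g n)))
    (subst (∣ f m ℚ.- f n ∣ ℚ.+ ∣ g m ℚ.- g n ∣ ℚ.<_) (halves ε)
      (ℚₚ.+-mono-<
        (close-f m n (ℕₚ.m⊔n≤o⇒m≤o M N hm) (ℕₚ.m⊔n≤o⇒m≤o M N hn))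
        (close-g m n (ℕₚ.m⊔n≤o⇒n≤o M N hm) (ℕₚ.m⊔n≤o⇒n≤o M N hn))))
  where
  open +-*-Solver
  regroup : ∀ a b c d → (a ℚ.+ b) ℚ.- (c ℚ.+ d) ≡ (a ℚ.- c) ℚ.+ (b ℚ.- d)
  regroup = solve 4 (λ a b c d → (a :+ b) :- (c :+ d) := (a :- c) :+ (b :- d)) refl
  halves : ∀ p → ½ ℚ.* p ℚ.+ ½ ℚ.* p ≡ p
  halves = solve 1 (λ p → con ½ :* p :+ con ½ :* p := p) refl
  ½ε>0 : 0ℚ ℚ.< ½ ℚ.* ε
  ½ε>0 = subst (ℚ._< ½ ℚ.* ε) (ℚₚ.*-zeroʳ ½) (ℚₚ.*-monoʳ-<-pos ½ ε>0)
  M       = proj₁ (cf (½ ℚ.* ε) ½ε>0)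
  close-f = proj₂ (cf (½ ℚ.* ε) ½ε>0)
  N       = proj₁ (cg (½ ℚ.* ε) ½ε>0)
  close-g = proj₂ (cg (½ ℚ.* ε) ½ε>0)

infixl 6 _+_

_+_ : ℝ → ℝ → ℝ
x + y = mkℝ (λ n → seq x n ℚ.+ seq y n) (+-cauchy (seq x) (seq y) (cauchy x) (cauchy y))

+-0-rawMonoid : RawMonoid 0ℓ 0ℓ
+-0-rawMonoid = record { Carrier = ℝ ; _≈_ = _≈_ ; _∙_ = _+_ ; ε = 0ℝ }

-- n · x is the n-fold sum x + ⋯ + x.
open MonoidOps +-0-rawMonoid public using (sum) renaming (_×_ to infixr 8 _·_)

------------------------------------------------------------------------
-- Finite simple graphs
--
-- The edge {u , v} is listed once, as the pair (u , v) with u < v.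

record Graph : Set where
  field
    ∣V∣ ∣E∣        : ℕ
    ends           : Fin ∣E∣ → Fin ∣V∣ × Fin ∣V∣
    ends-ordered   : ∀ e → proj₁ (ends e) Fin.< proj₂ (ends e)
    ends-injective : Injective _≡_ _≡_ ends

------------------------------------------------------------------------
-- Planarity: the vertices are distinct points of ℝ², the edges are simple
-- curves joining their endpoints, and no interior point of an edge is a
-- vertex or lies on another edge

Point : Set
Point = ℝ × ℝ

infix 4 _≈ₚ_

_≈ₚ_ : Rel Point 0ℓ
(x , y) ≈ₚ (x′ , y′) = x ≈ x′ × y ≈ y′

-- ∣ x - y ∣ < ε
Near : ℚ → Rel ℝ 0ℓ
Near ε x y = x < y + fromℚ ε × y < x + fromℚ ε

Nearₚ : ℚ → Rel Point 0ℓ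
Nearₚ ε (x , y) (x′ , y′) = Near ε x x′ × Near ε y y′

UnitInterval : Set
UnitInterval = Σ ℝ λ t → 0ℝ ≤ t × t ≤ 1ℝ

-- Taking ε arbitrarily small, continuity also makes γ respect _≈_.
Continuous : (UnitInterval → Point) → Set
Continuous γ = ∀ (t : UnitInterval) (ε : ℚ) → 0ℚ ℚ.< ε →
  ∃[ δ ] 0ℚ ℚ.< δ × (∀ s → Near δ (proj₁ s) (proj₁ t) → Nearₚ ε (γ s) (γ t))

record PlaneDrawing (G : Graph) : Set where
  open Graph G
  field
    point : Fin ∣V∣ → Point
    curve : Fin ∣E∣ → UnitInterval → Point

    point-injective  : ∀ u v → point u ≈ₚ point v → u ≡ v
    curve-continuous : ∀ e → Continuous (curve e)
    curve-injective  : ∀ e s t → curve e s ≈ₚ curve e t → proj₁ s ≈ proj₁ t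

    curve-start : ∀ e t → proj₁ t ≈ 0ℝ → curve e t ≈ₚ point (proj₁ (ends e))
    curve-end   : ∀ e t → proj₁ t ≈ 1ℝ → curve e t ≈ₚ point (proj₂ (ends e))

    interior-avoids-points : ∀ e t v → 0ℝ < proj₁ t → proj₁ t < 1ℝ →
      ¬ (curve e t ≈ₚ point v)
    interior-avoids-curves : ∀ e f t s → e ≢ f → 0ℝ < proj₁ t → proj₁ t < 1ℝ →
      ¬ (curve e t ≈ₚ curve f s)

Planar : Graph → Set
Planar = PlaneDrawing

------------------------------------------------------------------------
-- Terminal networks and their cuts

-- The terminal set Q is identified with Fin k, so networks with the same k
-- have the same terminals.
record Network (k : ℕ) : Set where
  field
    graph : Graph
  open Graph graph public
  field
    cost               : Fin ∣E∣ → ℝ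
    cost-positive      : ∀ e → 0ℝ < cost e
    terminal           : Fin k → Fin ∣V∣
    terminal-injective : Injective _≡_ _≡_ terminal

module _ {k : ℕ} (N : Network k) where
  open Network N

  cutCost : Subset ∣V∣ → ℝ
  cutCost W = sum λ e →
    if lookup W (proj₁ (ends e)) xor lookup W (proj₂ (ends e)) then cost e else 0ℝ

  Separates : Subset k → Subset ∣V∣ → Set
  Separates S W = (∀ q → terminal q ∈ W ⇔ q ∈ S) ⊎ (∀ q → terminal q ∈ W ⇔ q ∈ ∁ S)

  -- v is a lower bound that is attained. Which of the finitely many cuts
  -- attains it is undecidable for real costs, so attainment is doubly negated
  -- to avoid demanding an explicit minimiser.
  IsMincut : Subset k → ℝ → Set
  IsMincut S v = (∀ W → Separates S W → v ≤ cutCost W)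
               × ¬ ¬ (∃[ W ] Separates S W × cutCost W ≈ v)

IsMimicking : ∀ {k} → Network k → Network k → Set
IsMimicking N′ N = ∀ S → S ≢ ⊥ → S ≢ ⊤ → ∃[ v ] IsMincut N′ S v × IsMincut N S v

{-# OPTIONS --safe #-}

-- The network is a grid of n = ⌊k/4⌋ horizontal and n vertical lines whose ends are terminals. For
-- each of the n² blocks at the top left corner, take as S the terminals in the block. Every line
-- through the block must be cut once, and a cut with a vertex on another line cuts that line twice;
-- costs that are almost equal, and decrease away from the corner, thus make the block a minimum cut.
-- They are tuned so that the values of these cuts are A u − b^t for distinct digits t < n², hence
-- satisfy no linear relation with coefficients in (−b, b).
-- In a mimicking network with m edges these values are subset sums of m costs. If m < n², then by
-- the pigeonhole principle two distinct vectors in {0, …, b − 1}^(n²) combine the subsets to the same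
-- multiset of edges, which is such a relation.

module Submission where

open import Algebra.Bundles using (CommutativeMonoid)
open import Data.Bool.Base using (Bool; true; false; not; if_then_else_; _∧_; _xor_)
import Data.Bool.Properties as Boolₚ
open import Data.Fin.Base as Fin
  using (Fin; zero; suc; toℕ; inject₁; _↑ˡ_; _↑ʳ_; combine; remQuot; finToFun; funToFin; opposite; fromℕ<)
import Data.Fin.Properties as Finₚ
open import Data.Fin.Relation.Unary.Top using (view; ‵fromℕ; ‵inject₁)
open import Data.Fin.Subset using (Subset; _∈_; ∁; ⊥; ⊤; inside; outside)
import Data.Integer.Base as ℤ
import Data.Integer.Properties as ℤₚ
open import Data.Nat.Base as ℕ using (ℕ; zero; suc; _>_; _^_; z≤n; s≤s)
import Data.Nat.Coprimality as Coprimality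
open import Data.Nat.DivMod using (_divMod_; result)
import Data.Nat.Properties as ℕₚ
open import Data.Nat.Solver using (module +-*-Solver)
open import Data.Product using (∃-syntax; _×_; _,_; proj₁; proj₂; uncurry)
open import Data.Rational.Base as ℚ using (ℚ; 0ℚ; 1ℚ; ½; ∣_∣; mkℚ)
import Data.Rational.Properties as ℚₚ
import Data.Rational.Solver as ℚ-Solver
open import Data.Sum.Base using (_⊎_; inj₁; inj₂)
open import Data.Vec.Base using (lookup; tabulate)
import Data.Vec.Properties as Vecₚ
open import Function.Base using (_∘_; flip)
open import Function.Bundles using (_⇔_; mk⇔; Equivalence)
open import Level using (0ℓ)
open import Relation.Binary.PropositionalEquality hiding (setoid)
open import Relation.Nullary using (¬_; Dec; yes; no; contradiction)
open import Relation.Nullary.Decidable using (_×-dec_; decidable-stable)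

-- Independence of the values would suggest comparing ranks of incidence matrices. The costs of a
-- mimicking network are arbitrary Cauchy reals, however, whose equality cannot be decided, so
-- elimination is replaced by counting. A relation with coefficients of both signs is kept as an
-- equality of two combinations with natural coefficients; these need only sums and multiples and
-- make sense in every commutative monoid. Since counting yields a relation with bounded
-- coefficients, only such relations have to be excluded, and integer costs in the grid suffice for
-- that. Two demands on these costs conflict: independence calls for discounts of very different
-- sizes, minimality of the blocks for nearly equal costs. A base price of `n * D` on every edge
-- reconciles them: a block cuts at most `2 n` edges, so its cost exceeds the base prices by at most
-- `2 n D`, which is what two further edges cost at least.

-- Finite sums of natural numbers

module FiniteSums where
  open import Data.Nat.Base
  open import Algebra.Properties.Semiring.Sum ℕₚ.+-*-semiring public
    using (∑-comm; ∑-distrib-+; sum-cong-≗; *-distribˡ-sum)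
    renaming (sum to sumℕ)
  private variable m n : ℕ

  sum-mono : {f g : Fin m → ℕ} → (∀ i → f i ≤ g i) → sumℕ f ≤ sumℕ g
  sum-mono {zero}  le = z≤n
  sum-mono {suc m} le = ℕₚ.+-mono-≤ (le zero) (sum-mono (le ∘ suc))

  sum-mono-gap : {f g : Fin m → ℕ} {d : ℕ} → (∀ i → f i ≤ g i) →
                 ∀ i → f i + d ≤ g i → sumℕ f + d ≤ sumℕ g
  sum-mono-gap {suc m} {f} {g} {d} le zero gap = begin
    f zero + sumℕ (f ∘ suc) + d   ≡⟨ ℕₚ.+-assoc (f zero) _ d ⟩
    f zero + (sumℕ (f ∘ suc) + d) ≡⟨ cong (f zero +_) (ℕₚ.+-comm _ d) ⟩
    f zero + (d + sumℕ (f ∘ suc)) ≡⟨ ℕₚ.+-assoc (f zero) d _ ⟨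
    f zero + d + sumℕ (f ∘ suc)   ≤⟨ ℕₚ.+-mono-≤ gap (sum-mono (le ∘ suc)) ⟩
    g zero + sumℕ (g ∘ suc)       ∎
    where open ℕₚ.≤-Reasoning
  sum-mono-gap {suc m} {f} {g} {d} le (suc i) gap = begin
    f zero + sumℕ (f ∘ suc) + d   ≡⟨ ℕₚ.+-assoc (f zero) _ d ⟩
    f zero + (sumℕ (f ∘ suc) + d) ≤⟨ ℕₚ.+-mono-≤ (le zero) (sum-mono-gap (le ∘ suc) i gap) ⟩
    g zero + sumℕ (g ∘ suc)       ∎
    where open ℕₚ.≤-Reasoning

  sum-const : ∀ m c → sumℕ {m} (λ _ → c) ≡ m * c
  sum-const zero    c = refl
  sum-const (suc m) c = cong (c +_) (sum-const m c)

  sum-split : ∀ m {n} (f : Fin (m + n) → ℕ) → sumℕ f ≡ sumℕ (f ∘ (_↑ˡ n)) + sumℕ (f ∘ (m ↑ʳ_))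
  sum-split zero    f = refl
  sum-split (suc m) f =
    trans (cong (f zero +_) (sum-split m (f ∘ suc))) (sym (ℕₚ.+-assoc (f zero) _ _))

  sum-combine : ∀ m n (f : Fin (m * n) → ℕ) → sumℕ f ≡ sumℕ λ i → sumℕ λ j → f (combine {m} {n} i j)
  sum-combine zero    n f = refl
  sum-combine (suc m) n f = trans (sum-split n f)
    (cong (sumℕ (f ∘ (_↑ˡ (m * n))) +_) (sum-combine m n (f ∘ (n ↑ʳ_))))

open FiniteSums

-- Cuts of a path

module CutsOfAPath where
  open import Data.Nat.Base
  private variable m n : ℕ

  cutOn : (Fin (suc m) → Bool) → (Fin m → ℕ) → ℕ
  cutOn w c = sumℕ λ e → if w (inject₁ e) xor w (suc e) then c e else 0

  if-cut : ∀ x y c → x ≢ y → (if x xor y then c else 0) ≡ c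
  if-cut true  true  c ne = contradiction refl ne
  if-cut true  false c ne = refl
  if-cut false true  c ne = refl
  if-cut false false c ne = contradiction refl ne

  first-cut : ∀ (w : Fin (suc (suc m)) → Bool) (c : Fin (suc m) → ℕ) → w zero ≢ w (suc zero) →
              cutOn w c ≡ c zero + cutOn (w ∘ suc) (c ∘ suc)
  first-cut w c ne = cong (_+ cutOn (w ∘ suc) (c ∘ suc)) (if-cut (w zero) (w (suc zero)) (c zero) ne)

  -- The first edge at which `w` changes comes no later than `i`, so only the costs up to `i` need a
  -- lower bound. With decreasing costs, `a` can be the cost of edge `i` itself.
  cutOn-≥ : ∀ (w : Fin (suc m) → Bool) c {a} (i : Fin m) → (∀ e → toℕ e ≤ toℕ i → a ≤ c e) →
            w zero ≢ w (suc i) → a ≤ cutOn w c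
  cutOn-≥ {suc m} w c {a} i a≤c ne with w zero Boolₚ.≟ w (suc zero)
  ... | no 0≢1 = ℕₚ.≤-trans (ℕₚ.≤-trans (a≤c zero z≤n) (ℕₚ.m≤m+n (c zero) _))
                            (ℕₚ.≤-reflexive (sym (first-cut w c 0≢1)))
  cutOn-≥ {suc m} w c zero    a≤c ne | yes 0≡1 = contradiction 0≡1 ne
  cutOn-≥ {suc m} w c (suc i) a≤c ne | yes 0≡1 = ℕₚ.≤-trans
    (cutOn-≥ (w ∘ suc) (c ∘ suc) i (λ e e≤i → a≤c (suc e) (s≤s e≤i)) (ne ∘ trans 0≡1))
    (ℕₚ.m≤n+m _ _)

  cutOn-≥₁ : ∀ (w : Fin (suc m) → Bool) c {a} → (∀ e → a ≤ c e) →
             w zero ≢ w (Fin.fromℕ m) → a ≤ cutOn w c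
  cutOn-≥₁ {zero}  w c a≤c ne = contradiction refl ne
  cutOn-≥₁ {suc m} w c a≤c ne = cutOn-≥ w c (Fin.fromℕ m) (λ e _ → a≤c e) ne

  -- After the first change, the rest of the path still has to return to the initial value, which
  -- costs a second edge.
  cutOn-≥₂ : ∀ (w : Fin (suc m) → Bool) c {a} x → (∀ e → a ≤ c e) →
             w zero ≢ w x → w zero ≡ w (Fin.fromℕ m) → a + a ≤ cutOn w c
  cutOn-≥₂         w c zero    a≤c ne eq = contradiction refl ne
  cutOn-≥₂ {suc m} w c {a} (suc x) a≤c ne eq with w zero Boolₚ.≟ w (suc zero)
  ... | no 0≢1 = ℕₚ.≤-trans
    (ℕₚ.+-mono-≤ (a≤c zero)
      (cutOn-≥₁ (w ∘ suc) (c ∘ suc) (a≤c ∘ suc) λ 1≡m → 0≢1 (trans eq (sym 1≡m))))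
    (ℕₚ.≤-reflexive (sym (first-cut w c 0≢1)))
  ... | yes 0≡1 = ℕₚ.≤-trans
    (cutOn-≥₂ (w ∘ suc) (c ∘ suc) x (a≤c ∘ suc) (ne ∘ trans 0≡1) (trans (sym 0≡1) eq))
    (ℕₚ.m≤n+m _ _)

  infix 4 _≼_
  -- The two bounds may differ, so that positions on a line compare directly with line numbers;
  -- being recursive, `mid l ≼ suc I` computes to `inject₁ l ≼ I`.
  _≼_ : Fin m → Fin n → Bool
  zero  ≼ y     = true
  suc x ≼ zero  = false
  suc x ≼ suc y = x ≼ y

  inject₁-≼ : ∀ (x : Fin m) (y : Fin n) → (inject₁ x ≼ y) ≡ (x ≼ y)
  inject₁-≼ zero    y       = refl
  inject₁-≼ (suc x) zero    = refl
  inject₁-≼ (suc x) (suc y) = inject₁-≼ x y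

  fromℕ⋠ : ∀ (y : Fin m) → (Fin.fromℕ m ≼ y) ≡ false
  fromℕ⋠ zero    = refl
  fromℕ⋠ (suc y) = fromℕ⋠ y

  suc⋠ : ∀ (y : Fin m) → (Fin.suc y ≼ y) ≡ false
  suc⋠ zero    = refl
  suc⋠ (suc y) = suc⋠ y

  cutOn-false : ∀ (c : Fin m → ℕ) → cutOn (λ _ → false) c ≡ 0
  cutOn-false {m} c = trans (sum-const m 0) (ℕₚ.*-zeroʳ m)

  cutOn-≼ : ∀ (e : Fin m) (c : Fin m → ℕ) → cutOn (_≼ e) c ≡ c e
  cutOn-≼ zero    c = trans (cong (c zero +_) (cutOn-false (c ∘ suc))) (ℕₚ.+-identityʳ (c zero))
  cutOn-≼ (suc e) c = cutOn-≼ e (c ∘ suc)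

open CutsOfAPath

-- Minimality of blocks in a grid with nearly equal costs

module GridCuts where
  open import Data.Nat.Base

  -- One of the two families of parallel lines. The lines up to `I` pass through the block and leave
  -- it on their edge `suc J`; for the other family, `I` and `J` are exchanged.
  module Lines {n} (f : Fin n → Fin (2 + n) → Bool) (k : Fin n → Fin (1 + n) → ℕ) (I J : Fin n) where

    lineCuts target : ℕ
    lineCuts = sumℕ λ l → cutOn (f l) (k l)
    target   = sumℕ {n} λ l → if l ≼ I then k l (suc J) else 0

    count : ℕ → ℕ
    count a = sumℕ {n} λ l → if l ≼ I then a else 0

    Stray : Set
    Stray = ∃[ l ] (l ≼ I) ≡ false × (∃[ x ] f l x ≡ true)

    stray? : Dec Stray
    stray? = Finₚ.any? λ l → ((l ≼ I) Boolₚ.≟ false) ×-dec Finₚ.any? λ x → f l x Boolₚ.≟ true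

    target-≤ : ∀ {a d} → (∀ l e → k l e ≤ a + d) → target ≤ count a + n * d
    target-≤ {a} {d} k≤ = begin
      target                                  ≤⟨ sum-mono pointwise ⟩
      sumℕ {n} (λ l → (if l ≼ I then a else 0) + d) ≡⟨ ∑-distrib-+ {n} (λ l → if l ≼ I then a else 0) (λ _ → d) ⟩
      count a + sumℕ {n} (λ _ → d)             ≡⟨ cong (count a +_) (sum-const n d) ⟩
      count a + n * d                         ∎
      where
      open ℕₚ.≤-Reasoning
      pointwise : ∀ l → (if l ≼ I then k l (suc J) else 0) ≤ (if l ≼ I then a else 0) + d
      pointwise l with l ≼ I
      ... | true  = k≤ l (suc J)
      ... | false = z≤n

    module _ (start : ∀ l → f l zero ≡ (l ≼ I)) (end : ∀ l → f l (Fin.fromℕ (1 + n)) ≡ false) where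

      module _ {a} (a≤k : ∀ l e → a ≤ k l e) where

        line-≥ : ∀ l → (if l ≼ I then a else 0) ≤ cutOn (f l) (k l)
        line-≥ l with l ≼ I in eq
        ... | false = z≤n
        ... | true  = cutOn-≥₁ (f l) (k l) (a≤k l) λ 0≡end →
          contradiction (trans (sym (trans (start l) eq)) (trans 0≡end (end l))) λ ()

        count-≤ : count a ≤ lineCuts
        count-≤ = sum-mono {n} line-≥

        -- The stray line contributes nothing to `count a`, and since both its ends are labelled
        -- `false` it is cut at least twice.
        stray-≤ : Stray → count a + (a + a) ≤ lineCuts
        stray-≤ (l , l⋠I , x , flx) = sum-mono-gap {n} line-≥ l
          (subst (λ z → (if z then a else 0) + (a + a) ≤ cutOn (f l) (k l)) (sym l⋠I)
            (cutOn-≥₂ (f l) (k l) x (a≤k l)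
              (λ 0≡x → contradiction (trans (sym (trans (start l) l⋠I)) (trans 0≡x flx)) λ ())
              (trans (start l) (trans l⋠I (sym (end l))))))

      target-≤-lineCuts :
        (∀ l e → toℕ e ≤ toℕ (suc J) → k l (suc J) ≤ k l e) →
        (∀ l → f l (suc (suc J)) ≡ false) → target ≤ lineCuts
      target-≤-lineCuts k-antitone beyond = sum-mono pointwise
        where
        pointwise : ∀ l → (if l ≼ I then k l (suc J) else 0) ≤ cutOn (f l) (k l)
        pointwise l with l ≼ I in eq
        ... | false = z≤n
        ... | true  = cutOn-≥ (f l) (k l) (suc J) (k-antitone l) λ 0≡end →
          contradiction (trans (sym (trans (start l) eq)) (trans 0≡end (beyond l))) λ ()

  -- Positions `zero` and `fromℕ (1 + n)` are the two ends of a line; its crossings with the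
  -- perpendicular lines lie strictly between.
  mid : ∀ {n} → Fin n → Fin (2 + n)
  mid l = suc (inject₁ l)

  -- If g vanishes on the lines beyond J, it vanishes at the position just after J, which is either
  -- on such a line or the end of the grid.
  beyond : ∀ {n} (J : Fin n) (g : Fin (2 + n) → Bool) → g (Fin.fromℕ (1 + n)) ≡ false →
           (∀ l → (l ≼ J) ≡ false → g (mid l) ≡ false) → g (suc (suc J)) ≡ false
  beyond {n} J g end out = go (suc J) refl
    where
    go : ∀ x → x ≡ suc J → g (suc x) ≡ false
    go x eq with view x
    ... | ‵fromℕ     = end
    ... | ‵inject₁ l = out l (trans (sym (inject₁-≼ l J)) (trans (cong (_≼ J) eq) (suc⋠ J)))

  module Grid {n} (kʰ kᵛ : Fin n → Fin (1 + n) → ℕ) where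

    gridCut : (Fin (2 + n) → Fin (2 + n) → Bool) → ℕ
    gridCut w = sumℕ (λ p → cutOn (w (mid p)) (kʰ p)) + sumℕ (λ q → cutOn (flip w (mid q)) (kᵛ q))

    -- Positions count from the border, so `suc I` reaches exactly to line `I`. The block contains
    -- the left and top ends of its lines and the corner between them.
    block : Fin n → Fin n → Fin (2 + n) → Fin (2 + n) → Bool
    block I J p q = (p ≼ suc I) ∧ (q ≼ suc J)

    blockValue : Fin n → Fin n → ℕ
    blockValue I J = sumℕ (λ p → if p ≼ I then kʰ p (suc J) else 0)
                   + sumℕ (λ q → if q ≼ J then kᵛ q (suc I) else 0)

    gridCut-block : ∀ I J → gridCut (block I J) ≡ blockValue I J
    gridCut-block I J = cong₂ _+_ (sum-cong-≗ row) (sum-cong-≗ column)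
      where
      row : ∀ p → cutOn (block I J (mid p)) (kʰ p) ≡ (if p ≼ I then kʰ p (suc J) else 0)
      row p rewrite inject₁-≼ p I with p ≼ I
      ... | true  = cutOn-≼ (suc J) (kʰ p)
      ... | false = cutOn-false (kʰ p)
      column : ∀ q → cutOn (λ p → block I J p (mid q)) (kᵛ q) ≡ (if q ≼ J then kᵛ q (suc I) else 0)
      column q rewrite inject₁-≼ q J with q ≼ J
      ... | true  = trans (sum-cong-≗ λ e → cong₂ (λ x y → if x xor y then kᵛ q e else 0)
                      (Boolₚ.∧-identityʳ (inject₁ e ≼ suc I)) (Boolₚ.∧-identityʳ (suc e ≼ suc I)))
                    (cutOn-≼ (suc I) (kᵛ q))
      ... | false = trans (sum-cong-≗ λ e → cong₂ (λ x y → if x xor y then kᵛ q e else 0)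
                      (Boolₚ.∧-zeroʳ (inject₁ e ≼ suc I)) (Boolₚ.∧-zeroʳ (suc e ≼ suc I)))
                    (cutOn-false (kᵛ q))

    module _ (kʰ-antitone : ∀ l i e → toℕ e ≤ toℕ i → kʰ l i ≤ kʰ l e)
             (kᵛ-antitone : ∀ l i e → toℕ e ≤ toℕ i → kᵛ l i ≤ kᵛ l e)
             {a d} (nd≤a : n * d ≤ a)
             (a≤kʰ : ∀ l e → a ≤ kʰ l e) (kʰ≤ : ∀ l e → kʰ l e ≤ a + d)
             (a≤kᵛ : ∀ l e → a ≤ kᵛ l e) (kᵛ≤ : ∀ l e → kᵛ l e ≤ a + d)
             where

      -- In each direction the block exceeds the lower bound `count a` by at most `n * d ≤ a`, hence
      -- by at most `a + a` altogether. One stray vertex in either direction already makes `w` pay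
      -- this much more. Without stray vertices, the decreasing costs decide line by line.
      block-optimal : ∀ I J w →
        (∀ l → w (mid l) zero ≡ block I J (mid l) zero) →
        (∀ l → w (mid l) (Fin.fromℕ (1 + n)) ≡ block I J (mid l) (Fin.fromℕ (1 + n))) →
        (∀ l → w zero (mid l) ≡ block I J zero (mid l)) →
        (∀ l → w (Fin.fromℕ (1 + n)) (mid l) ≡ block I J (Fin.fromℕ (1 + n)) (mid l)) →
        blockValue I J ≤ gridCut w
      block-optimal I J w left right top bottom = cases H.stray? V.stray?
        where
        module H = Lines (w ∘ mid) kʰ I J
        module V = Lines (λ l x → w x (mid l)) kᵛ J I
        left′ : ∀ l → w (mid l) zero ≡ (l ≼ I)
        left′ l = trans (left l) (trans (Boolₚ.∧-identityʳ _) (inject₁-≼ l I))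
        right′ : ∀ l → w (mid l) (Fin.fromℕ (1 + n)) ≡ false
        right′ l = trans (right l) (trans (cong ((inject₁ l ≼ I) ∧_) (fromℕ⋠ J)) (Boolₚ.∧-zeroʳ _))
        top′ : ∀ l → w zero (mid l) ≡ (l ≼ J)
        top′ l = trans (top l) (inject₁-≼ l J)
        bottom′ : ∀ l → w (Fin.fromℕ (1 + n)) (mid l) ≡ false
        bottom′ l = trans (bottom l) (cong (_∧ (inject₁ l ≼ J)) (fromℕ⋠ I))

        upper : blockValue I J ≤ (H.count a + a) + (V.count a + a)
        upper = ℕₚ.+-mono-≤
          (ℕₚ.≤-trans (H.target-≤ {a} {d} kʰ≤) (ℕₚ.+-monoʳ-≤ (H.count a) nd≤a))
          (ℕₚ.≤-trans (V.target-≤ {a} {d} kᵛ≤) (ℕₚ.+-monoʳ-≤ (V.count a) nd≤a))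

        open +-*-Solver
        cases : Dec H.Stray → Dec V.Stray → blockValue I J ≤ gridCut w
        cases (yes s) _ = ℕₚ.≤-trans upper (ℕₚ.≤-trans
          (ℕₚ.≤-reflexive (solve 3 (λ x y z → (x :+ z) :+ (y :+ z) := (x :+ (z :+ z)) :+ y) refl
                                   (H.count a) (V.count a) a))
          (ℕₚ.+-mono-≤ (H.stray-≤ left′ right′ a≤kʰ s) (V.count-≤ top′ bottom′ a≤kᵛ)))
        cases (no _) (yes s) = ℕₚ.≤-trans upper (ℕₚ.≤-trans
          (ℕₚ.≤-reflexive (solve 3 (λ x y z → (x :+ z) :+ (y :+ z) := x :+ (y :+ (z :+ z))) refl
                                   (H.count a) (V.count a) a))
          (ℕₚ.+-mono-≤ (H.count-≤ left′ right′ a≤kʰ) (V.stray-≤ top′ bottom′ a≤kᵛ s)))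
        -- Each family confines the other: if the vertical lines past `J` carry no label `true`,
        -- every horizontal line is `false` just past the block, and so must be cut by then.
        cases (no ¬sʰ) (no ¬sᵛ) = ℕₚ.+-mono-≤
          (H.target-≤-lineCuts left′ right′ (λ l e → kʰ-antitone l (suc J) e)
            λ l → beyond J (w (mid l)) (right′ l) λ q q⋠J →
              Boolₚ.¬-not λ t → ¬sᵛ (q , q⋠J , mid l , t))
          (V.target-≤-lineCuts top′ bottom′ (λ l e → kᵛ-antitone l (suc I) e)
            λ l → beyond I (λ x → w x (mid l)) (bottom′ l) λ p p⋠I →
              Boolₚ.¬-not λ t → ¬sʰ (p , p⋠I , mid l , t))

open GridCuts

-- Costs that encode a power of `b` in every block value

module GenericCosts (n b′ : ℕ) where
  open import Data.Nat.Base

  -- No discount exceeds D, and with A = n * D + D a cut that pays for two more edges than the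
  -- block is dearer even if all its edges are discounted.
  b D A : ℕ
  b = suc b′
  D = b ^ (n * n)
  A = n * D + D

  -- The increments of the sequence of powers of `b`: first 1, then `b ^ (q + 1) − b ^ q`, so that
  -- initial sums are again powers of `b`.
  digit : ∀ {m} → Fin m → ℕ
  digit zero    = 1
  digit (suc q) = b′ * b ^ toℕ q

  -- The factor reserves `n` consecutive exponents for each row, so that the blocks use every
  -- exponent below `n * n` exactly once.
  discount : Fin n → Fin n → ℕ
  discount i q = b ^ (n * toℕ i) * digit q

  -- Stated for every `c`, because merging the first term of the sum into `c` replaces it by
  -- `c * b`.
  geometric-sum : ∀ {m} c (J : Fin m) →
    c + sumℕ {m} (λ q → if q ≼ J then c * (b′ * b ^ toℕ q) else 0) ≡ c * b ^ suc (toℕ J)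
  geometric-sum {suc m} c zero =
    trans (cong (λ s → c + (c * (b′ * 1) + s)) (trans (sum-const m 0) (ℕₚ.*-zeroʳ m)))
          (solve 2 (λ c b → c :+ (c :* (b :* con 1) :+ con 0) := c :* ((con 1 :+ b) :* con 1)) refl c b′)
    where open +-*-Solver
  geometric-sum {suc m} c (suc J) = begin
    c + (c * (b′ * 1) + sumℕ {m} (λ q → if q ≼ J then c * (b′ * b ^ suc (toℕ q)) else 0))
      ≡⟨ cong (λ s → c + (c * (b′ * 1) + s)) (sum-cong-≗ {m} λ q → cong (λ z → if q ≼ J then z else 0)
           (solve 3 (λ c b x → c :* (b :* ((con 1 :+ b) :* x)) := c :* (con 1 :+ b) :* (b :* x)) refl
                    c b′ (b ^ toℕ q))) ⟩
    c + (c * (b′ * 1) + sumℕ {m} (λ q → if q ≼ J then c * b * (b′ * b ^ toℕ q) else 0))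
      ≡⟨ solve 3 (λ c b s → c :+ (c :* (b :* con 1) :+ s) := c :* (con 1 :+ b) :+ s) refl c b′ _ ⟩
    c * b + sumℕ {m} (λ q → if q ≼ J then c * b * (b′ * b ^ toℕ q) else 0)
      ≡⟨ geometric-sum (c * b) J ⟩
    c * b * b ^ suc (toℕ J)
      ≡⟨ ℕₚ.*-assoc c b _ ⟩
    c * b ^ suc (suc (toℕ J)) ∎
    where open ≡-Reasoning
          open +-*-Solver

  digit-sum : ∀ {m} c (J : Fin m) → sumℕ {m} (λ q → if q ≼ J then c * digit q else 0) ≡ c * b ^ toℕ J
  digit-sum {suc m} c zero = trans (cong (c * 1 +_) (trans (sum-const m 0) (ℕₚ.*-zeroʳ m)))
                                   (ℕₚ.+-identityʳ (c * 1))
  digit-sum {suc m} c (suc J) = trans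
    (cong (_+ sumℕ {m} (λ q → if q ≼ J then c * (b′ * b ^ toℕ q) else 0)) (ℕₚ.*-identityʳ c))
    (geometric-sum c J)

  -- The discounts telescope in J, so that blockValue I J is a multiple of A minus a power of b.
  discount-sum : ∀ I J → sumℕ {n} (λ q → if q ≼ J then discount I q else 0) ≡ b ^ toℕ (combine I J)
  discount-sum I J = begin
    sumℕ {n} (λ q → if q ≼ J then discount I q else 0) ≡⟨ digit-sum {n} (b ^ (n * toℕ I)) J ⟩
    b ^ (n * toℕ I) * b ^ toℕ J                   ≡⟨ ℕₚ.^-distribˡ-+-* b (n * toℕ I) (toℕ J) ⟨
    b ^ (n * toℕ I + toℕ J)                       ≡⟨ cong (b ^_) (Finₚ.toℕ-combine {n} {n} I J) ⟨
    b ^ toℕ (combine I J)                         ∎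
    where open ≡-Reasoning

  term-≤-sum : ∀ {m} (J : Fin m) (f : Fin m → ℕ) → f J ≤ sumℕ {m} (λ q → if q ≼ J then f q else 0)
  term-≤-sum zero    f = ℕₚ.m≤m+n (f zero) _
  term-≤-sum (suc J) f = ℕₚ.≤-trans (term-≤-sum J (f ∘ suc)) (ℕₚ.m≤n+m _ (f zero))

  -- A discount is bounded by the partial sum that ends with it, a power of `b` with exponent below
  -- `n * n`.
  discount-≤ : ∀ I q → discount I q ≤ D
  discount-≤ I q = begin
    discount I q          ≤⟨ term-≤-sum q (discount I) ⟩
    _                     ≡⟨ discount-sum I q ⟩
    b ^ toℕ (combine I q) ≤⟨ ℕₚ.^-monoʳ-≤ b (ℕₚ.<⇒≤ (Finₚ.toℕ<n (combine I q))) ⟩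
    D                     ∎
    where open ℕₚ.≤-Reasoning

  discount-mono : ∀ {I I′} q → toℕ I ≤ toℕ I′ → discount I q ≤ discount I′ q
  discount-mono q I≤I′ = ℕₚ.*-monoˡ-≤ (digit q) (ℕₚ.^-monoʳ-≤ b (ℕₚ.*-monoʳ-≤ n I≤I′))

  -- Discounts in one direction suffice: a block `(I , J)` cuts the vertical lines `q` up to `J` on
  -- edge `suc I`, which collects the discounts of row `I`. Edge `zero` lies on the border side of
  -- all crossings and is cut by no block; its full price keeps the costs decreasing.
  kʰ kᵛ : Fin n → Fin (1 + n) → ℕ
  kʰ p e       = A
  kᵛ q zero    = A
  kᵛ q (suc i) = A ∸ discount i q

  D≤A : D ≤ A
  D≤A = ℕₚ.m≤n+m D (n * D)

  nD≤A : n * D ≤ A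
  nD≤A = ℕₚ.m≤m+n (n * D) D

  nD≤kᵛ : ∀ q e → n * D ≤ kᵛ q e
  nD≤kᵛ q zero    = nD≤A
  nD≤kᵛ q (suc i) = ℕₚ.≤-trans (ℕₚ.≤-reflexive (sym (ℕₚ.m+n∸n≡m (n * D) D)))
                               (ℕₚ.∸-monoʳ-≤ A (discount-≤ i q))

  kᵛ≤A : ∀ q e → kᵛ q e ≤ A
  kᵛ≤A q zero    = ℕₚ.≤-refl
  kᵛ≤A q (suc i) = ℕₚ.m∸n≤m A (discount i q)

  kᵛ-antitone : ∀ q i e → toℕ e ≤ toℕ i → kᵛ q i ≤ kᵛ q e
  kᵛ-antitone q i       zero    e≤i = kᵛ≤A q i
  kᵛ-antitone q (suc i) (suc e) (s≤s e≤i) = ℕₚ.∸-monoʳ-≤ A (discount-mono q e≤i)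

  open Grid kʰ kᵛ public

  block-minimal : ∀ I J w →
    (∀ l → w (mid l) zero ≡ block I J (mid l) zero) →
    (∀ l → w (mid l) (Fin.fromℕ (1 + n)) ≡ block I J (mid l) (Fin.fromℕ (1 + n))) →
    (∀ l → w zero (mid l) ≡ block I J zero (mid l)) →
    (∀ l → w (Fin.fromℕ (1 + n)) (mid l) ≡ block I J (Fin.fromℕ (1 + n)) (mid l)) →
    blockValue I J ≤ gridCut w
  -- Here `a = n * D` and `d = D`, so `n * d ≤ a` holds with equality and `A` is the maximal price
  -- `a + d`.
  block-minimal = block-optimal (λ _ _ _ _ → ℕₚ.≤-refl) kᵛ-antitone ℕₚ.≤-refl
    (λ _ _ → nD≤A) (λ _ _ → ℕₚ.≤-refl) nD≤kᵛ kᵛ≤A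

  multiplicity : Fin n → Fin n → ℕ
  multiplicity I J = sumℕ {n} (λ p → if p ≼ I then 1 else 0) + sumℕ {n} (λ q → if q ≼ J then 1 else 0)

  sum-if : ∀ (J : Fin n) → sumℕ {n} (λ q → if q ≼ J then A else 0) ≡
           A * sumℕ {n} (λ q → if q ≼ J then 1 else 0)
  sum-if J = trans (sum-cong-≗ {n} pointwise) (sym (*-distribˡ-sum {n} A (λ q → if q ≼ J then 1 else 0)))
    where
    pointwise : ∀ q → (if q ≼ J then A else 0) ≡ A * (if q ≼ J then 1 else 0)
    pointwise q with q ≼ J
    ... | true  = sym (ℕₚ.*-identityʳ A)
    ... | false = sym (ℕₚ.*-zeroʳ A)

  -- Refunding the discounts leaves the full price `A` for each cut edge. The additive form avoids
  -- truncated subtraction.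
  blockValue-digit : ∀ I J → b ^ toℕ (combine I J) + blockValue I J ≡ A * multiplicity I J
  blockValue-digit I J = begin
    b ^ toℕ (combine I J) + (hs + vs)
      ≡⟨ cong (_+ (hs + vs)) (discount-sum I J) ⟨
    ds + (hs + vs)
      ≡⟨ solve 3 (λ d h v → d :+ (h :+ v) := h :+ (d :+ v)) refl ds hs vs ⟩
    hs + (ds + vs)
      ≡⟨ cong (hs +_) (∑-distrib-+ {n} (λ q → if q ≼ J then discount I q else 0)
                                      (λ q → if q ≼ J then kᵛ q (suc I) else 0)) ⟨
    hs + sumℕ {n} (λ q → (if q ≼ J then discount I q else 0) + (if q ≼ J then kᵛ q (suc I) else 0))
      ≡⟨ cong (hs +_) (sum-cong-≗ {n} pointwise) ⟩
    hs + sumℕ {n} (λ q → if q ≼ J then A else 0)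
      ≡⟨ cong₂ _+_ (sum-if I) (sum-if J) ⟩
    A * sumℕ {n} (λ p → if p ≼ I then 1 else 0) + A * sumℕ {n} (λ q → if q ≼ J then 1 else 0)
      ≡⟨ ℕₚ.*-distribˡ-+ A (sumℕ {n} (λ p → if p ≼ I then 1 else 0)) _ ⟨
    A * multiplicity I J ∎
    where
    open ≡-Reasoning
    open +-*-Solver
    hs = sumℕ {n} (λ p → if p ≼ I then A else 0)
    ds = sumℕ {n} (λ q → if q ≼ J then discount I q else 0)
    vs = sumℕ {n} (λ q → if q ≼ J then kᵛ q (suc I) else 0)
    pointwise : ∀ q → (if q ≼ J then discount I q else 0) + (if q ≼ J then kᵛ q (suc I) else 0)
                    ≡ (if q ≼ J then A else 0)
    pointwise q with q ≼ J
    ... | true  = ℕₚ.m+[n∸m]≡n (ℕₚ.≤-trans (discount-≤ I q) D≤A)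
    ... | false = refl

-- Bounded integer relations: digits and pigeonholes

module IntegerRelations where
  open import Data.Nat.Base

  -- `funToFin` puts the most significant digit first, hence the `opposite`.
  toℕ-funToFin : ∀ {r b} (x : Fin r → Fin b) →
                 toℕ (funToFin x) ≡ sumℕ λ t → toℕ (x t) * b ^ toℕ (opposite t)
  toℕ-funToFin {zero}      x = refl
  toℕ-funToFin {suc r} {b} x = begin
    toℕ (combine (x zero) (funToFin (x ∘ suc)))
      ≡⟨ Finₚ.toℕ-combine (x zero) (funToFin (x ∘ suc)) ⟩
    b ^ r * toℕ (x zero) + toℕ (funToFin (x ∘ suc))
      ≡⟨ cong₂ _+_ (trans (ℕₚ.*-comm (b ^ r) _) (cong (λ k → toℕ (x zero) * b ^ k) (sym (Finₚ.toℕ-fromℕ r))))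
                   (trans (toℕ-funToFin (x ∘ suc))
                          (sum-cong-≗ λ t → cong (λ k → toℕ (x (suc t)) * b ^ k)
                                                 (sym (Finₚ.toℕ-inject₁ (opposite t))))) ⟩
    sumℕ (λ t → toℕ (x t) * b ^ toℕ (opposite t)) ∎
    where open ≡-Reasoning

  quotient-≤ : ∀ {A X Y S Q Q′} → X + S ≡ A * Q → Y + S ≡ A * Q′ → Y < A → Q′ ≤ Q
  quotient-≤ {A} {X} {Y} {S} {Q} {Q′} eq eq′ Y<A = ℕₚ.≮⇒≥ λ Q<Q′ → ℕₚ.<-irrefl refl (begin-strict
    Y + S     <⟨ ℕₚ.+-monoˡ-< S Y<A ⟩
    A + S     ≤⟨ ℕₚ.+-monoʳ-≤ A (ℕₚ.m≤n+m S X) ⟩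
    A + (X + S) ≡⟨ cong (A +_) eq ⟩
    A + A * Q ≡⟨ ℕₚ.*-suc A Q ⟨
    A * suc Q ≤⟨ ℕₚ.*-monoʳ-≤ A Q<Q′ ⟩
    A * Q′    ≡⟨ eq′ ⟨
    Y + S     ∎)
    where open ℕₚ.≤-Reasoning

  -- Both numbers are the reduced residue of `− S` modulo `A`.
  remainder-unique : ∀ {A X Y S} Q Q′ → X + S ≡ A * Q → Y + S ≡ A * Q′ → X < A → Y < A → X ≡ Y
  remainder-unique {A} {X} {Y} {S} Q Q′ eq eq′ X<A Y<A = ℕₚ.+-cancelʳ-≡ S X Y
    (trans eq (trans (cong (A *_) (ℕₚ.≤-antisym (quotient-≤ eq′ eq X<A) (quotient-≤ eq eq′ Y<A))) (sym eq′)))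

  -- The coefficient vector is given by the number `X` whose base `b` digits it lists. This serves
  -- both the pigeonhole principle on `Fin` and the recovery of `X` as a residue.
  combination : ∀ {r b} → Fin (b ^ r) → (Fin r → ℕ) → ℕ
  combination X v = sumℕ λ t → toℕ (finToFun X t) * v t

  -- Weighting the hypotheses on `v` by the digits of `X` and adding them up turns the powers of `b`
  -- into `X` itself: `X` plus the combination is a multiple of `A`. Thus the combination fixes `X`
  -- modulo `A`, and `X < b ^ r ≤ A`.
  combination-injective : ∀ {r b A} (v u : Fin r → ℕ) → b ^ r ≤ A →
    (∀ t → b ^ toℕ (opposite t) + v t ≡ A * u t) →
    ∀ (X Y : Fin (b ^ r)) → combination {r} {b} X v ≡ combination Y v → X ≡ Y
  combination-injective {r} {b} {A} v u b^r≤A v+b^t X Y eq = Finₚ.toℕ-injective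
    (remainder-unique (combination {r} {b} X u) (combination {r} {b} Y u)
      (split X) (trans (cong (toℕ Y +_) eq) (split Y)) (bounded X) (bounded Y))
    where
    open ≡-Reasoning
    open +-*-Solver
    bounded : ∀ X → toℕ X < A
    bounded X = ℕₚ.<-≤-trans (Finₚ.toℕ<n X) b^r≤A
    split : ∀ X → toℕ X + combination {r} {b} X v ≡ A * combination {r} {b} X u
    split X = begin
      toℕ X + combination {r} {b} X v
        ≡⟨ cong (λ Z → toℕ Z + combination {r} {b} X v) (Finₚ.funToFin-finToFin {r} {b} X) ⟨
      toℕ (funToFin (finToFun {b} {r} X)) + combination {r} {b} X v
        ≡⟨ cong (_+ combination {r} {b} X v) (toℕ-funToFin (finToFun {b} {r} X)) ⟩
      combination {r} {b} X (λ t → b ^ toℕ (opposite t)) + combination {r} {b} X v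
        ≡⟨ ∑-distrib-+ {r} (λ t → toℕ (finToFun {b} {r} X t) * b ^ toℕ (opposite t)) _ ⟨
      sumℕ {r} (λ t → toℕ (finToFun {b} {r} X t) * b ^ toℕ (opposite t) + toℕ (finToFun {b} {r} X t) * v t)
        ≡⟨ sum-cong-≗ {r} (λ t → trans (sym (ℕₚ.*-distribˡ-+ (toℕ (finToFun {b} {r} X t)) _ (v t)))
             (trans (cong (toℕ (finToFun {b} {r} X t) *_) (v+b^t t))
                    (solve 3 (λ x a u → x :* (a :* u) := a :* (x :* u)) refl
                             (toℕ (finToFun {b} {r} X t)) A (u t)))) ⟩
      sumℕ {r} (λ t → A * (toℕ (finToFun {b} {r} X t) * u t))
        ≡⟨ *-distribˡ-sum {r} A (λ t → toℕ (finToFun {b} {r} X t) * u t) ⟨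
      A * combination {r} {b} X u ∎

  *-^-distrib : ∀ m n k → (m * n) ^ k ≡ m ^ k * n ^ k
  *-^-distrib m n zero    = refl
  *-^-distrib m n (suc k) = trans (cong (m * n *_) (*-^-distrib m n k))
    (solve 4 (λ x y a b → x :* y :* (a :* b) := x :* a :* (y :* b)) refl m n (m ^ k) (n ^ k))
    where open +-*-Solver

  indicator : ∀ {r m} → (Fin r → Fin m → Bool) → Fin m → Fin r → ℕ
  indicator M e t = if M t e then 1 else 0

  -- There are b ^ r coefficient vectors but at most (r * b) ^ m values of the m combinations.
  collision : ∀ {r m b} → r ^ r < b → m < r → (M : Fin r → Fin m → Bool) →
    ∃[ X ] ∃[ Y ] X ≢ Y × (∀ e → combination {r} {b} X (indicator M e) ≡ combination {r} {b} Y (indicator M e))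
  collision {r@(suc _)} {m} {b@(suc b′)} r^r<b m<r M =
    let X , Y , X<Y , eq = Finₚ.pigeonhole fewer code
    in  X , Y , Finₚ.<⇒≢ X<Y , λ e → Finₚ.fromℕ<-injective _ _ (bound X e) (bound Y e)
          (trans (sym (Finₚ.finToFun-funToFin (codeAt X) e))
            (trans (cong (λ Z → finToFun {r * b} {m} Z e) eq) (Finₚ.finToFun-funToFin (codeAt Y) e)))
    where
    open ℕₚ.≤-Reasoning
    fewer : (r * b) ^ m < b ^ r
    fewer = begin-strict
      (r * b) ^ m   ≡⟨ *-^-distrib r b m ⟩
      r ^ m * b ^ m ≤⟨ ℕₚ.*-monoˡ-≤ (b ^ m) (ℕₚ.^-monoʳ-≤ r (ℕₚ.<⇒≤ m<r)) ⟩
      r ^ r * b ^ m <⟨ ℕₚ.*-monoˡ-< (b ^ m) {{ℕₚ.m^n≢0 b m}} r^r<b ⟩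
      b * b ^ m     ≤⟨ ℕₚ.^-monoʳ-≤ b m<r ⟩
      b ^ r         ∎
    term≤ : ∀ X e t → toℕ (finToFun {b} {r} X t) * indicator M e t ≤ b′
    term≤ X e t with M t e
    ... | true  = ℕₚ.≤-trans (ℕₚ.≤-reflexive (ℕₚ.*-identityʳ _)) (Finₚ.toℕ≤pred[n] (finToFun {b} {r} X t))
    ... | false = ℕₚ.≤-trans (ℕₚ.≤-reflexive (ℕₚ.*-zeroʳ (toℕ (finToFun {b} {r} X t)))) z≤n
    bound : ∀ X e → combination {r} {b} X (indicator M e) < r * b
    bound X e = begin-strict
      combination {r} {b} X (indicator M e) ≤⟨ sum-mono {r} (term≤ X e) ⟩
      sumℕ {r} (λ _ → b′)                ≡⟨ sum-const r b′ ⟩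
      r * b′                            <⟨ ℕₚ.*-monoʳ-< r (ℕₚ.n<1+n b′) ⟩
      r * b                             ∎
    codeAt : Fin (b ^ r) → Fin m → Fin (r * b)
    codeAt X e = fromℕ< (bound X e)
    code : Fin (b ^ r) → Fin ((r * b) ^ m)
    code X = funToFin (codeAt X)

-- Order and addition of Cauchy reals

open import Defs

ι : ℕ → ℚ
ι n = ℤ.+ n ℚ./ 1

-- The division by 1 normalises through a gcd that is stuck for a variable `n`; in constructor form,
-- sums and comparisons reduce to the numerators.
ι-canonical : ∀ n → ι n ≡ mkℚ (ℤ.+ n) 0 (Coprimality.sym (Coprimality.1-coprimeTo n))
ι-canonical n = ℚₚ.normalize-coprime (Coprimality.sym (Coprimality.1-coprimeTo n))

ι-+ : ∀ m n → ι (m ℕ.+ n) ≡ ι m ℚ.+ ι n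
ι-+ m n rewrite ι-canonical m | ι-canonical n =
  cong (ℚ._/ 1) (sym (cong₂ ℤ._+_ (ℤₚ.*-identityʳ (ℤ.+ m)) (ℤₚ.*-identityʳ (ℤ.+ n))))

ι-mono-≤ : ∀ {m n} → m ℕ.≤ n → ι m ℚ.≤ ι n
ι-mono-≤ {m} {n} m≤n rewrite ι-canonical m | ι-canonical n =
  ℚ.*≤* (ℤₚ.*-monoʳ-≤-nonNeg (ℤ.+ 1) (ℤ.+≤+ m≤n))

ι-mono-< : ∀ {m n} → m ℕ.< n → ι m ℚ.< ι n
ι-mono-< {m} {n} m<n rewrite ι-canonical m | ι-canonical n =
  ℚ.*<* (ℤₚ.*-monoʳ-<-pos (ℤ.+ 1) (ℤ.+<+ m<n))

<⇒≱ : ∀ {p q} → p ℚ.< q → ¬ q ℚ.≤ p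
<⇒≱ p<q q≤p = ℚₚ.<-irrefl refl (ℚₚ.<-≤-trans p<q q≤p)

p≤∣p∣ : ∀ p → p ℚ.≤ ∣ p ∣
p≤∣p∣ p with ℚₚ.≤-total 0ℚ p
... | inj₁ 0≤p = ℚₚ.≤-reflexive (sym (ℚₚ.0≤p⇒∣p∣≡p 0≤p))
... | inj₂ p≤0 = ℚₚ.≤-trans p≤0 (ℚₚ.0≤∣p∣ p)

halve : ∀ ε → 0ℚ ℚ.< ε → ∃[ δ ] 0ℚ ℚ.< δ × δ ℚ.+ δ ≡ ε
halve ε ε>0 = ½ ℚ.* ε , subst (ℚ._< ½ ℚ.* ε) (ℚₚ.*-zeroʳ ½) (ℚₚ.*-monoʳ-<-pos ½ ε>0) ,
              solve 1 (λ p → con ½ :* p :+ con ½ :* p := p) refl ε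
  where open ℚ-Solver.+-*-Solver

≤-+pos : ∀ p {ε} → 0ℚ ℚ.< ε → p ℚ.≤ p ℚ.+ ε
≤-+pos p {ε} ε>0 = subst (ℚ._≤ p ℚ.+ ε) (ℚₚ.+-identityʳ p) (ℚₚ.+-monoʳ-≤ p (ℚₚ.<⇒≤ ε>0))

<-+pos : ∀ p {ε} → 0ℚ ℚ.< ε → p ℚ.< p ℚ.+ ε
<-+pos p {ε} ε>0 = subst (ℚ._< p ℚ.+ ε) (ℚₚ.+-identityʳ p) (ℚₚ.+-monoʳ-< p ε>0)

eventually₂ : ∀ {P Q R : ℕ → Set} → (∀ n → P n → Q n → R n) →
  ∃[ N ] (∀ n → N ℕ.≤ n → P n) → ∃[ N ] (∀ n → N ℕ.≤ n → Q n) → ∃[ N ] (∀ n → N ℕ.≤ n → R n)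
eventually₂ f (M , p) (N , q) = M ℕ.⊔ N , λ n le →
  f n (p n (ℕₚ.m⊔n≤o⇒m≤o M N le)) (q n (ℕₚ.m⊔n≤o⇒n≤o M N le))

pointwise⇒≤ : ∀ {x y} → (∀ n → seq x n ℚ.≤ seq y n) → x ≤ y
pointwise⇒≤ {x} {y} le ε ε>0 = 0 , λ n _ → ℚₚ.≤-trans (le n) (≤-+pos (seq y n) ε>0)

-- Delivers the tolerance already split into two halves, one for each of two estimates.
half-ind : ∀ (P : ℚ → Set) → (∀ δ → 0ℚ ℚ.< δ → P (δ ℚ.+ δ)) → ∀ ε → 0ℚ ℚ.< ε → P ε
half-ind P step ε ε>0 = let δ , δ>0 , δ+δ≡ε = halve ε ε>0 in subst P δ+δ≡ε (step δ δ>0)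

≤-trans : ∀ {x y z} → x ≤ y → y ≤ z → x ≤ z
≤-trans {x} {y} {z} x≤y y≤z = half-ind _ λ δ δ>0 →
  eventually₂ (λ n p q → ℚₚ.≤-trans p (ℚₚ.≤-trans (ℚₚ.+-monoˡ-≤ δ q)
        (ℚₚ.≤-reflexive (ℚₚ.+-assoc (seq z n) δ δ)))) (x≤y δ δ>0) (y≤z δ δ>0)

+-mono-≤ : ∀ {x y u v} → x ≤ y → u ≤ v → x + u ≤ y + v
+-mono-≤ {x} {y} {u} {v} x≤y u≤v = half-ind _ λ δ δ>0 →
  eventually₂ (λ n p q → ℚₚ.≤-trans (ℚₚ.+-mono-≤ p q)
        (ℚₚ.≤-reflexive (solve 3 (λ a b d → (a :+ d) :+ (b :+ d) := (a :+ b) :+ (d :+ d)) refl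
                                 (seq y n) (seq v n) δ)))
        (x≤y δ δ>0) (u≤v δ δ>0)
  where open ℚ-Solver.+-*-Solver

≈⇒≤ : ∀ {x y} → x ≈ y → x ≤ y
≈⇒≤ {x} {y} x≈y ε ε>0 = let N , close = x≈y ε ε>0 in N , λ n N≤n → ℚₚ.≤-trans
        (ℚₚ.≤-reflexive (solve 2 (λ a b → a := b :+ (a :- b)) refl (seq x n) (seq y n)))
        (ℚₚ.+-monoʳ-≤ (seq y n) (ℚₚ.≤-trans (p≤∣p∣ _) (ℚₚ.<⇒≤ (close n N≤n))))
  where open ℚ-Solver.+-*-Solver

∣∣-bound : ∀ {p q δ} → p ℚ.≤ q ℚ.+ δ → q ℚ.≤ p ℚ.+ δ → ∣ p ℚ.- q ∣ ℚ.≤ δ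
∣∣-bound {p} {q} {δ} p≤ q≤ with ℚₚ.∣p∣≡p∨∣p∣≡-p (p ℚ.- q)
... | inj₁ eq = ℚₚ.≤-trans (ℚₚ.≤-reflexive eq) (ℚₚ.≤-trans (ℚₚ.+-monoˡ-≤ (ℚ.- q) p≤)
        (ℚₚ.≤-reflexive (solve 2 (λ q d → (q :+ d) :- q := d) refl q δ)))
  where open ℚ-Solver.+-*-Solver
... | inj₂ eq = ℚₚ.≤-trans (ℚₚ.≤-reflexive (trans eq (solve 2 (λ p q → :- (p :- q) := q :- p) refl p q)))
        (ℚₚ.≤-trans (ℚₚ.+-monoˡ-≤ (ℚ.- p) q≤)
        (ℚₚ.≤-reflexive (solve 2 (λ q d → (q :+ d) :- q := d) refl p δ)))
  where open ℚ-Solver.+-*-Solver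

≤-antisym : ∀ {x y} → x ≤ y → y ≤ x → x ≈ y
≤-antisym {x} {y} x≤y y≤x = half-ind _ λ δ δ>0 →
  eventually₂ (λ n p q → ℚₚ.≤-<-trans (∣∣-bound p q) (<-+pos δ δ>0))
                                   (x≤y δ δ>0) (y≤x δ δ>0)

≗⇒≈ : ∀ {x y} → (∀ n → seq x n ≡ seq y n) → x ≈ y
≗⇒≈ {x} {y} eq = ≤-antisym {x} {y} (pointwise⇒≤ {x} {y} λ n → ℚₚ.≤-reflexive (eq n))
                                   (pointwise⇒≤ {y} {x} λ n → ℚₚ.≤-reflexive (sym (eq n)))

≈-refl : ∀ {x} → x ≈ x
≈-refl {x} = ≗⇒≈ {x} {x} λ _ → refl

≈-sym : ∀ {x y} → x ≈ y → y ≈ x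
≈-sym {x} {y} x≈y ε ε>0 = let N , close = x≈y ε ε>0 in N , λ n N≤n → ℚₚ.≤-<-trans (ℚₚ.≤-reflexive (trans
        (cong ∣_∣ (solve 2 (λ a b → b :- a := :- (a :- b)) refl (seq x n) (seq y n)))
        (ℚₚ.∣-p∣≡∣p∣ (seq x n ℚ.- seq y n)))) (close n N≤n)
  where open ℚ-Solver.+-*-Solver

≈⇒≥ : ∀ {x y} → x ≈ y → y ≤ x
≈⇒≥ {x} {y} x≈y = ≈⇒≤ {y} {x} (≈-sym {x} {y} x≈y)

≈-trans : ∀ {x y z} → x ≈ y → y ≈ z → x ≈ z
≈-trans {x} {y} {z} x≈y y≈z = ≤-antisym {x} {z}
  (≤-trans {x} {y} {z} (≈⇒≤ {x} {y} x≈y) (≈⇒≤ {y} {z} y≈z))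
  (≤-trans {z} {y} {x} (≈⇒≥ {y} {z} y≈z) (≈⇒≥ {x} {y} x≈y))

+-cong : ∀ {x y u v} → x ≈ y → u ≈ v → x + u ≈ y + v
+-cong {x} {y} {u} {v} x≈y u≈v = ≤-antisym {x + u} {y + v}
  (+-mono-≤ {x} {y} {u} {v} (≈⇒≤ {x} {y} x≈y) (≈⇒≤ {u} {v} u≈v))
  (+-mono-≤ {y} {x} {v} {u} (≈⇒≥ {x} {y} x≈y) (≈⇒≥ {u} {v} u≈v))

-- Its operations are those of `+-0-rawMonoid`, so results about sums in a commutative monoid apply
-- to `sum` as it stands.
+-0-commutativeMonoid : CommutativeMonoid 0ℓ 0ℓ
+-0-commutativeMonoid = record
  { Carrier = ℝ ; _≈_ = _≈_ ; _∙_ = _+_ ; ε = 0ℝ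
  ; isCommutativeMonoid = record
    { isMonoid = record
      { isSemigroup = record
        { isMagma = record
          { isEquivalence = record
            { refl  = λ {x} → ≈-refl {x}
            ; sym   = λ {x} {y} → ≈-sym {x} {y}
            ; trans = λ {x} {y} {z} → ≈-trans {x} {y} {z} }
          ; ∙-cong = λ {x} {y} {u} {v} → +-cong {x} {y} {u} {v} }
        ; assoc = λ x y z → ≗⇒≈ {x + y + z} {x + (y + z)} λ n → ℚₚ.+-assoc (seq x n) (seq y n) (seq z n) }
      ; identity = (λ x → ≗⇒≈ {0ℝ + x} {x} λ n → ℚₚ.+-identityˡ (seq x n))
                 , (λ x → ≗⇒≈ {x + 0ℝ} {x} λ n → ℚₚ.+-identityʳ (seq x n)) }
    ; comm = λ x y → ≗⇒≈ {x + y} {y + x} λ n → ℚₚ.+-comm (seq x n) (seq y n) } }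

-- Half of the gap between `x` and `y` absorbs the error of `y ≤ z`; the other half remains as the
-- new gap.
<-≤-trans : ∀ {x y z} → x < y → y ≤ z → x < z
<-≤-trans {x} {y} {z} (ε , ε>0 , x<y) y≤z = half-ind
  (λ ε → (∃[ N ] (∀ n → N ℕ.≤ n → seq x n ℚ.+ ε ℚ.≤ seq y n)) → x < z)
  (λ δ δ>0 x<y → δ , δ>0 , eventually₂ (λ n p q → ℚₚ.≤-trans
        (ℚₚ.≤-reflexive (solve 2 (λ a d → a :+ d := (a :+ (d :+ d)) :- d) refl (seq x n) δ))
        (ℚₚ.≤-trans (ℚₚ.+-monoˡ-≤ (ℚ.- δ) (ℚₚ.≤-trans p q))
        (ℚₚ.≤-reflexive (solve 2 (λ a d → (a :+ d) :- d := a) refl (seq z n) δ))))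
        x<y (y≤z δ δ>0)) ε ε>0 x<y
  where open ℚ-Solver.+-*-Solver

≤-<-trans : ∀ {x y z} → x ≤ y → y < z → x < z
≤-<-trans {x} {y} {z} x≤y (ε , ε>0 , y<z) = half-ind
  (λ ε → (∃[ N ] (∀ n → N ℕ.≤ n → seq y n ℚ.+ ε ℚ.≤ seq z n)) → x < z)
  (λ δ δ>0 y<z → δ , δ>0 , eventually₂ (λ n p q → ℚₚ.≤-trans (ℚₚ.+-monoˡ-≤ δ p)
        (ℚₚ.≤-trans (ℚₚ.≤-reflexive (ℚₚ.+-assoc (seq y n) δ δ)) q))
        (x≤y δ δ>0) y<z) ε ε>0 y<z

+-monoʳ-< : ∀ z {x y} → x < y → z + x < z + y
+-monoʳ-< z {x} (ε , ε>0 , N , x<y) = ε , ε>0 , N , λ n N≤n → ℚₚ.≤-trans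
  (ℚₚ.≤-reflexive (ℚₚ.+-assoc (seq z n) (seq x n) ε)) (ℚₚ.+-monoʳ-≤ (seq z n) (x<y n N≤n))

+-cancelˡ : ∀ z {x y} → z + x ≈ z + y → x ≈ y
+-cancelˡ z {x} {y} eq ε ε>0 = let N , close = eq ε ε>0 in N , λ n N≤n → subst (λ p → ∣ p ∣ ℚ.< ε)
        (solve 3 (λ a b c → (c :+ a) :- (c :+ b) := a :- b) refl (seq x n) (seq y n) (seq z n)) (close n N≤n)
  where open ℚ-Solver.+-*-Solver

<-+fromℚ : ∀ x {ε} → 0ℚ ℚ.< ε → x < x + fromℚ ε
<-+fromℚ x ε>0 = _ , ε>0 , 0 , λ _ _ → ℚₚ.≤-refl

fromℕ-+ : ∀ m n → fromℕ (m ℕ.+ n) ≈ fromℕ m + fromℕ n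
fromℕ-+ m n = ≗⇒≈ {fromℕ (m ℕ.+ n)} {fromℕ m + fromℕ n} λ _ → ι-+ m n

fromℕ-mono-≤ : ∀ {m n} → m ℕ.≤ n → fromℕ m ≤ fromℕ n
fromℕ-mono-≤ {m} {n} m≤n = pointwise⇒≤ {fromℕ m} {fromℕ n} λ _ → ι-mono-≤ m≤n

fromℕ-mono-< : ∀ {m n} → m ℕ.< n → fromℕ m < fromℕ n
fromℕ-mono-< {m} {n} m<n = 1ℚ , ι-mono-< {0} {1} (s≤s z≤n) , 0 , λ _ _ →
  ℚₚ.≤-trans (ℚₚ.≤-reflexive (sym (ι-+ m 1)))
             (ι-mono-≤ (ℕₚ.≤-trans (ℕₚ.≤-reflexive (ℕₚ.+-comm m 1)) m<n))

fromℕ-cancel-< : ∀ {m n} → fromℕ m < fromℕ n → m ℕ.< n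
fromℕ-cancel-< {m} {n} (ε , ε>0 , N , m<n) = ℕₚ.≰⇒> λ n≤m →
  <⇒≱ (<-+pos (ι m) ε>0) (ℚₚ.≤-trans (m<n N ℕₚ.≤-refl) (ι-mono-≤ n≤m))

<-irrefl : ∀ {x y} → x < y → ¬ y ≤ x
<-irrefl {x} {y} x<y y≤x = let ε , ε>0 , N , x<x = <-≤-trans {x} {y} {x} x<y y≤x in
  <⇒≱ (<-+pos (seq x N) ε>0) (x<x N ℕₚ.≤-refl)

fromℕ-cancel-≤ : ∀ {m n} → fromℕ m ≤ fromℕ n → m ℕ.≤ n
fromℕ-cancel-≤ {m} {n} m≤n = ℕₚ.≮⇒≥ λ n<m →
  <-irrefl {fromℕ n} {fromℕ m} (fromℕ-mono-< n<m) m≤n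

fromℕ-injective : ∀ {m n} → fromℕ m ≈ fromℕ n → m ≡ n
fromℕ-injective {m} {n} eq = ℕₚ.≤-antisym
  (fromℕ-cancel-≤ (≈⇒≤ {fromℕ m} {fromℕ n} eq)) (fromℕ-cancel-≤ (≈⇒≥ {fromℕ m} {fromℕ n} eq))

-- Relations between subset sums in a commutative monoid

-- The monoid is kept abstract: unfolding _≈_ on ℝ would defeat unification.
module RelationsInMonoid {a ℓ} (M : CommutativeMonoid a ℓ) where
  open CommutativeMonoid M
    renaming (refl to ≈ᴹ-refl; sym to ≈ᴹ-sym; trans to ≈ᴹ-trans; _≈_ to _≈ᴹ_)
  open import Algebra.Properties.CommutativeMonoid.Sum M
    using (sum-cong-≋)
    renaming (sum to sumᴹ; ∑-comm to ∑-commᴹ)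
  open import Algebra.Properties.CommutativeMonoid.Mult M
    using (×-homo-+; ×-congʳ; ×-distrib-+) renaming (_×_ to _×ᴹ_)
  open import Relation.Binary.Reasoning.Setoid setoid

  sum-× : ∀ {m} (f : Fin m → ℕ) x → sumᴹ (λ t → f t ×ᴹ x) ≈ᴹ sumℕ f ×ᴹ x
  sum-× {zero}  f x = ≈ᴹ-refl
  sum-× {suc m} f x = ≈ᴹ-trans (∙-congˡ (sum-× (f ∘ suc) x)) (≈ᴹ-sym (×-homo-+ x (f zero) (sumℕ (f ∘ suc))))

  ×-sum : ∀ {m} k (f : Fin m → Carrier) → k ×ᴹ sumᴹ f ≈ᴹ sumᴹ (λ e → k ×ᴹ f e)
  ×-sum {zero}  zero    f = ≈ᴹ-refl
  ×-sum {zero}  (suc k) f = ≈ᴹ-trans (identityˡ _) (×-sum {zero} k f)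
  ×-sum {suc m} k       f = ≈ᴹ-trans (×-distrib-+ (f zero) _ k) (∙-congˡ (×-sum k (f ∘ suc)))

  ×-if : ∀ k c x → k ×ᴹ (if c then x else ε) ≈ᴹ (k ℕ.* (if c then 1 else 0)) ×ᴹ x
  ×-if k true  x = reflexive (cong (_×ᴹ x) (sym (ℕₚ.*-identityʳ k)))
  ×-if k false x = ≈ᴹ-trans (×ε k) (reflexive (cong (_×ᴹ x) (sym (ℕₚ.*-zeroʳ k))))
    where
    ×ε : ∀ k → k ×ᴹ ε ≈ᴹ ε
    ×ε zero    = ≈ᴹ-refl
    ×ε (suc k) = ≈ᴹ-trans (identityˡ _) (×ε k)

  module _ (φ : ℕ → Carrier) (φ-0 : φ 0 ≈ᴹ ε) (φ-+ : ∀ m n → φ (m ℕ.+ n) ≈ᴹ φ m ∙ φ n) where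

    φ-sum : ∀ {m} (f : Fin m → ℕ) → sumᴹ (φ ∘ f) ≈ᴹ φ (sumℕ f)
    φ-sum {zero}  f = ≈ᴹ-sym φ-0
    φ-sum {suc m} f = ≈ᴹ-trans (∙-congˡ (φ-sum (f ∘ suc))) (≈ᴹ-sym (φ-+ (f zero) _))

    φ-× : ∀ k n → k ×ᴹ φ n ≈ᴹ φ (k ℕ.* n)
    φ-× zero    n = ≈ᴹ-sym φ-0
    φ-× (suc k) n = ≈ᴹ-trans (∙-congˡ (φ-× k n)) (≈ᴹ-sym (φ-+ n (k ℕ.* n)))

    open IntegerRelations

    -- With m < r summands, some two of the combinations with coefficients below b use every
    -- summand equally often, hence agree; but the values v determine the coefficients.
    few-subset-sums : ∀ {r m b A} (v u : Fin r → ℕ) → (∀ {m n} → φ m ≈ᴹ φ n → m ≡ n) →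
      r ^ r ℕ.< b → b ^ r ℕ.≤ A → (∀ t → b ^ toℕ (opposite t) ℕ.+ v t ≡ A ℕ.* u t) →
      (c : Fin m → Carrier) (S : Fin r → Fin m → Bool) →
      (∀ t → sumᴹ (λ e → if S t e then c e else ε) ≈ᴹ φ (v t)) → r ℕ.≤ m
    few-subset-sums {r} {m} {b} v u φ-injective r^r<b b^r≤A v+b^t c S sums = ℕₚ.≮⇒≥ λ m<r →
      let X , Y , X≢Y , same = collision {r} {m} {b} r^r<b m<r S
      in  X≢Y (combination-injective {r} {b} v u b^r≤A v+b^t X Y (φ-injective (begin
            φ (combination {r} {b} X v)   ≈⟨ expand X ⟩
            sumᴹ (λ e → combination {r} {b} X (indicator S e) ×ᴹ c e)
              ≈⟨ sum-cong-≋ (λ e → reflexive (cong (_×ᴹ c e) (same e))) ⟩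
            sumᴹ (λ e → combination {r} {b} Y (indicator S e) ×ᴹ c e)
              ≈⟨ expand Y ⟨
            φ (combination {r} {b} Y v) ∎)))
      where
      expand : ∀ X → φ (combination {r} {b} X v) ≈ᴹ sumᴹ (λ e → combination {r} {b} X (indicator S e) ×ᴹ c e)
      expand X = begin
        φ (sumℕ (λ t → x t ℕ.* v t))
          ≈⟨ φ-sum (λ t → x t ℕ.* v t) ⟨
        sumᴹ (λ t → φ (x t ℕ.* v t))
          ≈⟨ sum-cong-≋ (λ t → ≈ᴹ-sym (φ-× (x t) (v t))) ⟩
        sumᴹ (λ t → x t ×ᴹ φ (v t))
          ≈⟨ sum-cong-≋ (λ t → ×-congʳ (x t) (≈ᴹ-sym (sums t))) ⟩
        sumᴹ (λ t → x t ×ᴹ sumᴹ (λ e → if S t e then c e else ε))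
          ≈⟨ sum-cong-≋ (λ t → ×-sum (x t) (λ e → if S t e then c e else ε)) ⟩
        sumᴹ (λ t → sumᴹ (λ e → x t ×ᴹ (if S t e then c e else ε)))
          ≈⟨ sum-cong-≋ (λ t → sum-cong-≋ (λ e → ×-if (x t) (S t e) (c e))) ⟩
        sumᴹ (λ t → sumᴹ (λ e → (x t ℕ.* indicator S e t) ×ᴹ c e))
          ≈⟨ ∑-commᴹ (λ t e → (x t ℕ.* indicator S e t) ×ᴹ c e) ⟩
        sumᴹ (λ e → sumᴹ (λ t → (x t ℕ.* indicator S e t) ×ᴹ c e))
          ≈⟨ sum-cong-≋ (λ e → sum-× (λ t → x t ℕ.* indicator S e t) (c e)) ⟩
        sumᴹ (λ e → combination {r} {b} X (indicator S e) ×ᴹ c e) ∎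
        where
        x : Fin r → ℕ
        x t = toℕ (finToFun {b} {r} X t)

open RelationsInMonoid +-0-commutativeMonoid using (few-subset-sums; φ-sum; φ-×)

sum-fromℕ : ∀ {m} (f : Fin m → ℕ) → sum (fromℕ ∘ f) ≈ fromℕ (sumℕ f)
sum-fromℕ = φ-sum fromℕ (≈-refl {0ℝ}) fromℕ-+

-- Drawing in the integer grid

module GridDrawing where

  translate-0 : ∀ a t → t ≈ 0ℝ → fromℕ a + t ≈ fromℕ a
  translate-0 a t t≈0 = ≈-trans {fromℕ a + t} {fromℕ a + 0ℝ} {fromℕ a}
    (+-cong {fromℕ a} {fromℕ a} {t} {0ℝ} (≈-refl {fromℕ a}) t≈0)
    (CommutativeMonoid.identityʳ +-0-commutativeMonoid (fromℕ a))

  suc-fromℕ : ∀ a → fromℕ a + 1ℝ ≈ fromℕ (suc a)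
  suc-fromℕ a = ≈-trans {fromℕ a + 1ℝ} {1ℝ + fromℕ a} {fromℕ (suc a)}
    (CommutativeMonoid.comm +-0-commutativeMonoid (fromℕ a) 1ℝ)
    (≈-sym {fromℕ (suc a)} {1ℝ + fromℕ a} (fromℕ-+ 1 a))

  translate-1 : ∀ a t → t ≈ 1ℝ → fromℕ a + t ≈ fromℕ (suc a)
  translate-1 a t t≈1 = ≈-trans {fromℕ a + t} {fromℕ a + 1ℝ} {fromℕ (suc a)}
    (+-cong {fromℕ a} {fromℕ a} {t} {1ℝ} (≈-refl {fromℕ a}) t≈1) (suc-fromℕ a)

  translate-> : ∀ a t → 0ℝ < t → fromℕ a < fromℕ a + t
  translate-> a t 0<t = ≤-<-trans {fromℕ a} {fromℕ a + 0ℝ} {fromℕ a + t}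
    (≈⇒≥ {fromℕ a + 0ℝ} {fromℕ a} (translate-0 a 0ℝ (≈-refl {0ℝ}))) (+-monoʳ-< (fromℕ a) {0ℝ} {t} 0<t)

  translate-< : ∀ a t → t < 1ℝ → fromℕ a + t < fromℕ (suc a)
  translate-< a t t<1 = <-≤-trans {fromℕ a + t} {fromℕ a + 1ℝ} {fromℕ (suc a)}
    (+-monoʳ-< (fromℕ a) {t} {1ℝ} t<1) (≈⇒≤ {fromℕ a + 1ℝ} {fromℕ (suc a)} (suc-fromℕ a))

  translate-≥ : ∀ a t → 0ℝ ≤ t → fromℕ a ≤ fromℕ a + t
  translate-≥ a t 0≤t = ≤-trans {fromℕ a} {fromℕ a + 0ℝ} {fromℕ a + t}
    (≈⇒≥ {fromℕ a + 0ℝ} {fromℕ a} (translate-0 a 0ℝ (≈-refl {0ℝ})))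
    (+-mono-≤ {fromℕ a} {fromℕ a} {0ℝ} {t} (≈⇒≤ {fromℕ a} {fromℕ a} (≈-refl {fromℕ a})) 0≤t)

  translate-≤ : ∀ a t → t ≤ 1ℝ → fromℕ a + t ≤ fromℕ (suc a)
  translate-≤ a t t≤1 = ≤-trans {fromℕ a + t} {fromℕ a + 1ℝ} {fromℕ (suc a)}
    (+-mono-≤ {fromℕ a} {fromℕ a} {t} {1ℝ} (≈⇒≤ {fromℕ a} {fromℕ a} (≈-refl {fromℕ a})) t≤1)
    (≈⇒≤ {fromℕ a + 1ℝ} {fromℕ (suc a)} (suc-fromℕ a))

  interior-not-integer : ∀ a t b → 0ℝ < t → t < 1ℝ → ¬ (fromℕ a + t ≈ fromℕ b)
  interior-not-integer a t b 0<t t<1 eq = ℕₚ.<-irrefl refl (ℕₚ.<-≤-trans a<b (ℕ.s≤s⁻¹ b<1+a))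
    where
    a<b : a ℕ.< b
    a<b = fromℕ-cancel-< {a} {b} (<-≤-trans {fromℕ a} {fromℕ a + t} {fromℕ b} (translate-> a t 0<t)
      (≈⇒≤ {fromℕ a + t} {fromℕ b} eq))
    b<1+a : b ℕ.< suc a
    b<1+a = fromℕ-cancel-< {b} {suc a} (≤-<-trans {fromℕ b} {fromℕ a + t} {fromℕ (suc a)}
      (≈⇒≥ {fromℕ a + t} {fromℕ b} eq) (translate-< a t t<1))

  -- It is enough that one of the two points is interior: `a < a + t ≈ b + s ≤ b + 1` and
  -- `b ≤ b + s ≈ a + t < a + 1`.
  same-unit : ∀ a t b s → 0ℝ < t → t < 1ℝ → 0ℝ ≤ s → s ≤ 1ℝ → fromℕ a + t ≈ fromℕ b + s → a ≡ b
  same-unit a t b s 0<t t<1 0≤s s≤1 eq = ℕₚ.≤-antisym (ℕ.s≤s⁻¹ a<1+b) (ℕ.s≤s⁻¹ b<1+a)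
    where
    a<1+b : a ℕ.< suc b
    a<1+b = fromℕ-cancel-< {a} {suc b} (<-≤-trans {fromℕ a} {fromℕ a + t} {fromℕ (suc b)}
      (translate-> a t 0<t)
      (≤-trans {fromℕ a + t} {fromℕ b + s} {fromℕ (suc b)}
        (≈⇒≤ {fromℕ a + t} {fromℕ b + s} eq) (translate-≤ b s s≤1)))
    b<1+a : b ℕ.< suc a
    b<1+a = fromℕ-cancel-< {b} {suc a} (≤-<-trans {fromℕ b} {fromℕ a + t} {fromℕ (suc a)}
      (≤-trans {fromℕ b} {fromℕ b + s} {fromℕ a + t}
        (translate-≥ b s 0≤s) (≈⇒≥ {fromℕ a + t} {fromℕ b + s} eq))
      (translate-< a t t<1))

  near-refl : ∀ x ε → 0ℚ ℚ.< ε → Near ε x x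
  near-refl x ε ε>0 = <-+fromℚ x ε>0 , <-+fromℚ x ε>0

  translate-near : ∀ z x y ε → Near ε x y → Near ε (z + x) (z + y)
  translate-near z x y ε (x<y+ε , y<x+ε) = half x y x<y+ε , half y x y<x+ε
    where
    half : ∀ x y → x < y + fromℚ ε → z + x < z + y + fromℚ ε
    half x y lt = <-≤-trans {z + x} {z + (y + fromℚ ε)} {z + y + fromℚ ε}
      (+-monoʳ-< z {x} {y + fromℚ ε} lt)
      (≈⇒≥ {z + y + fromℚ ε} {z + (y + fromℚ ε)}
        (CommutativeMonoid.assoc +-0-commutativeMonoid z y (fromℚ ε)))

open GridDrawing

-- The grid network and its planar drawing

inject₁≢suc : ∀ {n} (i : Fin n) → inject₁ i ≢ suc i
inject₁≢suc (suc i) eq = inject₁≢suc i (Finₚ.suc-injective eq)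

combine-monoʳ-< : ∀ {m n} (i : Fin m) {j k : Fin n} → toℕ j ℕ.< toℕ k →
                  toℕ (combine i j) ℕ.< toℕ (combine i k)
combine-monoʳ-< {m} {n} i {j} {k} j<k rewrite Finₚ.toℕ-combine i j | Finₚ.toℕ-combine i k =
  ℕₚ.+-monoʳ-< (n ℕ.* toℕ i) j<k

-- The n horizontal and n vertical lines have their ends on the sides of the square, whose corners are
-- isolated vertices. Besides the 4 n ends, r < 4 corners are terminals, so that every k is reached.
module GridNetwork (n b′ : ℕ) (0<n : 0 ℕ.< n) (r : Fin 4) where
  open GenericCosts n b′

  size k : ℕ
  size = 2 ℕ.+ n
  k    = toℕ r ℕ.+ n ℕ.* 4

  last : Fin size
  last = Fin.fromℕ (1 ℕ.+ n)

  Vertex : Set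
  Vertex = Fin (size ℕ.* size)

  -- Abstract, since otherwise combine unfolds and the coordinates cannot be inferred by unification.
  abstract
    vertex : Fin size → Fin size → Vertex
    vertex = combine

    coordinates : Vertex → Fin size × Fin size
    coordinates = remQuot size

    coordinates-vertex : ∀ p q → coordinates (vertex p q) ≡ (p , q)
    coordinates-vertex = Finₚ.remQuot-combine

    vertex-coordinates : ∀ v → uncurry vertex (coordinates v) ≡ v
    vertex-coordinates = Finₚ.combine-remQuot {size} size

    vertex-monoˡ : ∀ {p p′} q → toℕ p ℕ.< toℕ p′ → vertex p q Fin.< vertex p′ q
    vertex-monoˡ q p<p′ = Finₚ.combine-monoˡ-< q q p<p′

    vertex-monoʳ : ∀ p {q q′} → toℕ q ℕ.< toℕ q′ → vertex p q Fin.< vertex p q′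
    vertex-monoʳ p q<q′ = combine-monoʳ-< p q<q′

  vertex-injective : ∀ {p q p′ q′} → vertex p q ≡ vertex p′ q′ → p ≡ p′ × q ≡ q′
  vertex-injective {p} {q} {p′} {q′} eq = cong proj₁ eq′ , cong proj₂ eq′
    where eq′ = trans (sym (coordinates-vertex p q)) (trans (cong coordinates eq) (coordinates-vertex p′ q′))

  coordinates-injective : ∀ u v → coordinates u ≡ coordinates v → u ≡ v
  coordinates-injective u v eq =
    trans (sym (vertex-coordinates u)) (trans (cong (uncurry vertex) eq) (vertex-coordinates v))

  mid-injective : ∀ {l l′ : Fin n} → mid l ≡ mid l′ → l ≡ l′
  mid-injective eq = Finₚ.inject₁-injective (Finₚ.suc-injective eq)

  mid≢last : ∀ {l} → mid l ≢ last
  mid≢last eq = Finₚ.fromℕ≢inject₁ (sym (Finₚ.suc-injective eq))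

  data Segment : Set where
    horizontal vertical : (l : Fin n) (e : Fin (1 ℕ.+ n)) → Segment

  source target : Segment → Vertex
  source (horizontal l e) = vertex (mid l) (inject₁ e)
  source (vertical l e)   = vertex (inject₁ e) (mid l)
  target (horizontal l e) = vertex (mid l) (suc e)
  target (vertical l e)   = vertex (suc e) (mid l)

  source<target : ∀ s → source s Fin.< target s
  source<target (horizontal l e) = vertex-monoʳ (mid l) (s≤s (ℕₚ.≤-reflexive (Finₚ.toℕ-inject₁ e)))
  source<target (vertical l e)   = vertex-monoˡ (mid l) (s≤s (ℕₚ.≤-reflexive (Finₚ.toℕ-inject₁ e)))

  ends-determine : ∀ s s′ → source s ≡ source s′ → target s ≡ target s′ → s ≡ s′
  ends-determine (horizontal l e) (horizontal l′ e′) eq _ =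
    let eqˡ , eqʳ = vertex-injective eq in cong₂ horizontal (mid-injective eqˡ) (Finₚ.inject₁-injective eqʳ)
  ends-determine (vertical l e) (vertical l′ e′) eq _ =
    let eqˡ , eqʳ = vertex-injective eq in cong₂ vertical (mid-injective eqʳ) (Finₚ.inject₁-injective eqˡ)
  -- A horizontal edge stays in its row, a vertical edge changes it.
  ends-determine (horizontal l e) (vertical l′ e′) eq eq′ = contradiction
    (trans (sym (proj₁ (vertex-injective eq))) (proj₁ (vertex-injective eq′))) (inject₁≢suc e′)
  ends-determine (vertical l e) (horizontal l′ e′) eq eq′ = contradiction
    (trans (proj₁ (vertex-injective eq)) (sym (proj₁ (vertex-injective eq′)))) (inject₁≢suc e)

  Edge : Set
  Edge = Fin (2 ℕ.* (n ℕ.* (1 ℕ.+ n)))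

  fromTriple : Fin 2 → Fin n → Fin (1 ℕ.+ n) → Segment
  fromTriple zero       = horizontal
  fromTriple (suc zero) = vertical

  index : Segment → Edge
  index (horizontal l e) = combine {2} zero (combine l e)
  index (vertical l e)   = combine {2} (suc zero) (combine l e)

  abstract
    fromPair : Fin 2 × Fin (n ℕ.* (1 ℕ.+ n)) → Segment
    fromPair (d , j) = uncurry (fromTriple d) (remQuot (1 ℕ.+ n) j)

    segment : Edge → Segment
    segment i = fromPair (remQuot (n ℕ.* (1 ℕ.+ n)) i)

    index-fromPair : ∀ x → index (fromPair x) ≡ uncurry combine x
    index-fromPair (zero     , j) = cong (combine {2} zero) (Finₚ.combine-remQuot {n} (1 ℕ.+ n) j)
    index-fromPair (suc zero , j) = cong (combine {2} (suc zero)) (Finₚ.combine-remQuot {n} (1 ℕ.+ n) j)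

    index-segment : ∀ i → index (segment i) ≡ i
    index-segment i = trans (index-fromPair (remQuot {2} (n ℕ.* (1 ℕ.+ n)) i))
                            (Finₚ.combine-remQuot {2} (n ℕ.* (1 ℕ.+ n)) i)

    segment-combine : ∀ d l e → segment (combine d (combine l e)) ≡ fromTriple d l e
    segment-combine d l e = trans (cong fromPair (Finₚ.remQuot-combine {2} d (combine l e)))
                                  (cong (uncurry (fromTriple d)) (Finₚ.remQuot-combine l e))

  segment-injective : ∀ i j → segment i ≡ segment j → i ≡ j
  segment-injective i j eq = trans (sym (index-segment i)) (trans (cong index eq) (index-segment j))

  sum-segment : ∀ (f : Segment → ℕ) → sumℕ (f ∘ segment) ≡
    sumℕ (λ l → sumℕ (λ e → f (horizontal l e))) ℕ.+ sumℕ (λ l → sumℕ (λ e → f (vertical l e)))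
  sum-segment f = begin
    sumℕ (f ∘ segment)
      ≡⟨ sum-combine 2 (n ℕ.* (1 ℕ.+ n)) (f ∘ segment) ⟩
    part zero ℕ.+ (part (suc zero) ℕ.+ 0)
      ≡⟨ cong (part zero ℕ.+_) (ℕₚ.+-identityʳ (part (suc zero))) ⟩
    part zero ℕ.+ part (suc zero)
      ≡⟨ cong₂ ℕ._+_ (part-sum zero) (part-sum (suc zero)) ⟩
    sumℕ (λ l → sumℕ (λ e → f (horizontal l e))) ℕ.+ sumℕ (λ l → sumℕ (λ e → f (vertical l e))) ∎
    where
    open ≡-Reasoning
    part : Fin 2 → ℕ
    part d = sumℕ {n ℕ.* (1 ℕ.+ n)} λ j → f (segment (combine d j))
    part-sum : ∀ d → part d ≡ sumℕ {n} (λ l → sumℕ (λ e → f (fromTriple d l e)))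
    part-sum d = trans (sum-combine n (1 ℕ.+ n) (λ j → f (segment (combine d j))))
      (sum-cong-≗ {n} λ l → sum-cong-≗ λ e → cong f (segment-combine d l e))

  graph : Graph
  graph = record
    { ∣V∣            = size ℕ.* size
    ; ∣E∣            = 2 ℕ.* (n ℕ.* (1 ℕ.+ n))
    ; ends           = λ i → source (segment i) , target (segment i)
    ; ends-ordered   = source<target ∘ segment
    ; ends-injective = λ eq → segment-injective _ _ (ends-determine _ _ (cong proj₁ eq) (cong proj₂ eq))
    }

  end : Fin 2 → Fin size
  end zero       = zero
  end (suc zero) = last

  end-injective : ∀ x y → end x ≡ end y → x ≡ y
  end-injective zero       zero       eq = refl
  end-injective zero       (suc zero) ()
  end-injective (suc zero) zero       ()
  end-injective (suc zero) (suc zero) eq = refl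

  end≢mid : ∀ x l → end x ≢ mid l
  end≢mid (suc zero) l eq = mid≢last (sym eq)

  -- The first bit is the direction of the line, the second selects one of its ends.
  lineEnd : Fin 2 × Fin 2 → Fin n → Vertex
  lineEnd (zero     , x) l = vertex (mid l) (end x)
  lineEnd (suc zero , x) l = vertex (end x) (mid l)

  lineEnd-injective : ∀ s l s′ l′ → lineEnd s l ≡ lineEnd s′ l′ → s ≡ s′ × l ≡ l′
  lineEnd-injective (zero , x) l (zero , x′) l′ eq =
    let eqˡ , eqʳ = vertex-injective eq in cong (zero ,_) (end-injective x x′ eqʳ) , mid-injective eqˡ
  lineEnd-injective (suc zero , x) l (suc zero , x′) l′ eq =
    let eqˡ , eqʳ = vertex-injective eq in cong (suc zero ,_) (end-injective x x′ eqˡ) , mid-injective eqʳ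
  lineEnd-injective (zero , x) l (suc zero , x′) l′ eq =
    contradiction (sym (proj₁ (vertex-injective eq))) (end≢mid x′ l)
  lineEnd-injective (suc zero , x) l (zero , x′) l′ eq =
    contradiction (proj₁ (vertex-injective eq)) (end≢mid x l′)

  corner : Fin 2 × Fin 2 → Vertex
  corner (x , y) = vertex (end x) (end y)

  corner-injective : ∀ c c′ → corner c ≡ corner c′ → c ≡ c′
  corner-injective (x , y) (x′ , y′) eq =
    let eqˡ , eqʳ = vertex-injective eq in cong₂ _,_ (end-injective x x′ eqˡ) (end-injective y y′ eqʳ)

  corner≢lineEnd : ∀ c s l → corner c ≢ lineEnd s l
  corner≢lineEnd (x , y) (zero     , _) l eq = end≢mid x l (proj₁ (vertex-injective eq))
  corner≢lineEnd (x , y) (suc zero , _) l eq = end≢mid y l (proj₂ (vertex-injective eq))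

  abstract
    bits : Fin 4 → Fin 2 × Fin 2
    bits = remQuot {2} 2

    bits-injective : ∀ x y → bits x ≡ bits y → x ≡ y
    bits-injective x y eq = trans (sym (Finₚ.combine-remQuot {2} 2 x))
      (trans (cong (uncurry combine) eq) (Finₚ.combine-remQuot {2} 2 y))

    bits-surjective : ∀ s → ∃[ x ] bits x ≡ s
    bits-surjective (x , y) = combine x y , Finₚ.remQuot-combine x y

  fromEnd : Fin n × Fin 4 → Vertex
  fromEnd (l , s) = lineEnd (bits s) l

  fromEnd-injective : ∀ x y → fromEnd x ≡ fromEnd y → x ≡ y
  fromEnd-injective (l , s) (l′ , s′) eq =
    let eq-s , eq-l = lineEnd-injective (bits s) l (bits s′) l′ eq
    in  cong₂ _,_ eq-l (bits-injective s s′ eq-s)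

  place : Fin (toℕ r) ⊎ Fin (n ℕ.* 4) → Vertex
  place (inj₁ c) = corner (bits (Fin.inject c))
  place (inj₂ i) = fromEnd (remQuot 4 i)

  place-injective : ∀ x y → place x ≡ place y → x ≡ y
  place-injective (inj₁ c) (inj₁ c′) eq = cong inj₁ (Finₚ.toℕ-injective (trans (sym (Finₚ.toℕ-inject c))
    (trans (cong toℕ (bits-injective (Fin.inject c) (Fin.inject c′) (corner-injective _ _ eq)))
           (Finₚ.toℕ-inject c′))))
  place-injective (inj₁ c) (inj₂ i) eq = contradiction eq
    (corner≢lineEnd (bits (Fin.inject c)) (bits (proj₂ (remQuot {n} 4 i))) (proj₁ (remQuot {n} 4 i)))
  place-injective (inj₂ i) (inj₁ c) eq = contradiction (sym eq)
    (corner≢lineEnd (bits (Fin.inject c)) (bits (proj₂ (remQuot {n} 4 i))) (proj₁ (remQuot {n} 4 i)))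
  place-injective (inj₂ i) (inj₂ j) eq = cong inj₂ (trans (sym (Finₚ.combine-remQuot {n} 4 i))
    (trans (cong (uncurry combine) (fromEnd-injective (remQuot {n} 4 i) (remQuot {n} 4 j) eq))
           (Finₚ.combine-remQuot {n} 4 j)))

  abstract
    terminal : Fin k → Vertex
    terminal i = place (Fin.splitAt (toℕ r) i)

    terminal-injective : ∀ {i j} → terminal i ≡ terminal j → i ≡ j
    terminal-injective {i} {j} eq = trans (sym (Finₚ.join-splitAt (toℕ r) (n ℕ.* 4) i))
      (trans (cong (Fin.join (toℕ r) (n ℕ.* 4))
                   (place-injective (Fin.splitAt (toℕ r) i) (Fin.splitAt (toℕ r) j) eq))
             (Finₚ.join-splitAt (toℕ r) (n ℕ.* 4) j))

    lineEnd-terminal : ∀ s l → ∃[ i ] terminal i ≡ lineEnd s l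
    lineEnd-terminal s l = let x , bits-x = bits-surjective s in toℕ r Fin.↑ʳ combine l x ,
      trans (cong place (Finₚ.splitAt-↑ʳ (toℕ r) (n ℕ.* 4) (combine l x)))
        (trans (cong fromEnd (Finₚ.remQuot-combine l x)) (cong (λ s → lineEnd s l) bits-x))

  segmentCost : Segment → ℕ
  segmentCost (horizontal l e) = kʰ l e
  segmentCost (vertical l e)   = kᵛ l e

  segmentCost-positive : ∀ s → 0 ℕ.< segmentCost s
  segmentCost-positive s = ℕₚ.<-≤-trans (ℕₚ.*-mono-< 0<n 0<D) (nD≤ s)
    where
    0<D : 0 ℕ.< D
    0<D = ℕₚ.m^n>0 b (n ℕ.* n)
    nD≤ : ∀ s → n ℕ.* D ℕ.≤ segmentCost s
    nD≤ (horizontal l e) = nD≤A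
    nD≤ (vertical l e)   = nD≤kᵛ l e

  network : Network k
  network = record
    { graph              = graph
    ; cost               = fromℕ ∘ segmentCost ∘ segment
    ; cost-positive      = λ i → fromℕ-mono-< {0} (segmentCost-positive (segment i))
    ; terminal           = terminal
    ; terminal-injective = terminal-injective
    }

  coordinate : Fin size → ℝ
  coordinate = fromℕ ∘ toℕ

  position : Vertex → Point
  position v = let p , q = coordinates v in coordinate p , coordinate q

  position-vertex : ∀ p q → position (vertex p q) ≡ (coordinate p , coordinate q)
  position-vertex p q = cong (λ (p , q) → coordinate p , coordinate q) (coordinates-vertex p q)

  trace : Segment → ℝ → Point
  trace (horizontal l e) t = coordinate (mid l) , fromℕ (toℕ e) + t
  trace (vertical l e)   t = fromℕ (toℕ e) + t , coordinate (mid l)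

  ends-at : ∀ s t p q → trace s t ≈ₚ (coordinate p , coordinate q) → trace s t ≈ₚ position (vertex p q)
  ends-at s t p q = subst (trace s t ≈ₚ_) (sym (position-vertex p q))

  translate-start : ∀ {m} (e : Fin m) t → t ≈ 0ℝ → fromℕ (toℕ e) + t ≈ fromℕ (toℕ (inject₁ e))
  translate-start e t t≈0 = subst (λ a → fromℕ (toℕ e) + t ≈ fromℕ a) (sym (Finₚ.toℕ-inject₁ e))
                                  (translate-0 (toℕ e) t t≈0)

  trace-start : ∀ s t → t ≈ 0ℝ → trace s t ≈ₚ position (source s)
  trace-start (horizontal l e) t t≈0 = ends-at (horizontal l e) t (mid l) (inject₁ e)
    (≈-refl {coordinate (mid l)} , translate-start e t t≈0)
  trace-start (vertical l e) t t≈0 = ends-at (vertical l e) t (inject₁ e) (mid l)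
    (translate-start e t t≈0 , ≈-refl {coordinate (mid l)})

  trace-end : ∀ s t → t ≈ 1ℝ → trace s t ≈ₚ position (target s)
  trace-end (horizontal l e) t t≈1 = ends-at (horizontal l e) t (mid l) (suc e)
    (≈-refl {coordinate (mid l)} , translate-1 (toℕ e) t t≈1)
  trace-end (vertical l e) t t≈1 = ends-at (vertical l e) t (suc e) (mid l)
    (translate-1 (toℕ e) t t≈1 , ≈-refl {coordinate (mid l)})

  trace-continuous : ∀ s → Continuous (trace s ∘ proj₁)
  trace-continuous (horizontal l e) t ε ε>0 = ε , ε>0 , λ u near →
    near-refl (coordinate (mid l)) ε ε>0 , translate-near (fromℕ (toℕ e)) (proj₁ u) (proj₁ t) ε near
  trace-continuous (vertical l e) t ε ε>0 = ε , ε>0 , λ u near →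
    translate-near (fromℕ (toℕ e)) (proj₁ u) (proj₁ t) ε near , near-refl (coordinate (mid l)) ε ε>0

  trace-injective : ∀ s t u → trace s t ≈ₚ trace s u → t ≈ u
  trace-injective (horizontal l e) t u (_ , eq) = +-cancelˡ (fromℕ (toℕ e)) {t} {u} eq
  trace-injective (vertical l e)   t u (eq , _) = +-cancelˡ (fromℕ (toℕ e)) {t} {u} eq

  trace-avoids-vertices : ∀ s t v → 0ℝ < t → t < 1ℝ → ¬ trace s t ≈ₚ position v
  trace-avoids-vertices (horizontal l e) t v 0<t t<1 (_ , eq) =
    interior-not-integer (toℕ e) t (toℕ (proj₂ (coordinates v))) 0<t t<1 eq
  trace-avoids-vertices (vertical l e) t v 0<t t<1 (eq , _) =
    interior-not-integer (toℕ e) t (toℕ (proj₁ (coordinates v))) 0<t t<1 eq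

  trace-avoids-traces : ∀ s s′ t u → s ≢ s′ → 0ℝ < t → t < 1ℝ → 0ℝ ≤ u → u ≤ 1ℝ →
                        ¬ trace s t ≈ₚ trace s′ u
  trace-avoids-traces (horizontal l e) (horizontal l′ e′) t u ne 0<t t<1 0≤u u≤1 (eqˡ , eqʳ) =
    ne (cong₂ horizontal
      (mid-injective (Finₚ.toℕ-injective (fromℕ-injective eqˡ)))
      (Finₚ.toℕ-injective (same-unit (toℕ e) t (toℕ e′) u 0<t t<1 0≤u u≤1 eqʳ)))
  trace-avoids-traces (vertical l e) (vertical l′ e′) t u ne 0<t t<1 0≤u u≤1 (eqˡ , eqʳ) =
    ne (cong₂ vertical
      (mid-injective (Finₚ.toℕ-injective (fromℕ-injective eqʳ)))
      (Finₚ.toℕ-injective (same-unit (toℕ e) t (toℕ e′) u 0<t t<1 0≤u u≤1 eqˡ)))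
  -- All of the perpendicular line has one integer coordinate, a value that the moving coordinate
  -- takes at no interior point of the edge.
  trace-avoids-traces (horizontal l e) (vertical l′ e′) t u ne 0<t t<1 0≤u u≤1 (_ , eq) =
    interior-not-integer (toℕ e) t (toℕ (mid l′)) 0<t t<1 eq
  trace-avoids-traces (vertical l e) (horizontal l′ e′) t u ne 0<t t<1 0≤u u≤1 (eq , _) =
    interior-not-integer (toℕ e) t (toℕ (mid l′)) 0<t t<1 eq

  planar : Planar graph
  planar = record
    { point                  = position
    ; curve                  = λ i t → trace (segment i) (proj₁ t)
    ; point-injective        = λ u v (eqˡ , eqʳ) → coordinates-injective u v
        (cong₂ _,_ (Finₚ.toℕ-injective (fromℕ-injective eqˡ)) (Finₚ.toℕ-injective (fromℕ-injective eqʳ)))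
    ; curve-continuous       = trace-continuous ∘ segment
    ; curve-injective        = λ i t u → trace-injective (segment i) (proj₁ t) (proj₁ u)
    ; curve-start            = λ i t → trace-start (segment i) (proj₁ t)
    ; curve-end              = λ i t → trace-end (segment i) (proj₁ t)
    ; interior-avoids-points = λ i t → trace-avoids-vertices (segment i) (proj₁ t)
    ; interior-avoids-curves = λ { i j (t , _) (u , 0≤u , u≤1) i≢j 0<t t<1 →
        trace-avoids-traces (segment i) (segment j) t u (i≢j ∘ segment-injective i j) 0<t t<1 0≤u u≤1 }
    }

-- Minimum cuts of the grid network

private variable m n : ℕ

∈-lookup : ∀ {p : Subset m} {q : Subset n} {x y} → lookup p x ≡ lookup q y → x ∈ p ⇔ y ∈ q
∈-lookup {p = p} {q} {x} {y} eq = mk⇔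
  (λ x∈p → Vecₚ.lookup⇒[]= y q (trans (sym eq) (Vecₚ.[]=⇒lookup x∈p)))
  (λ y∈q → Vecₚ.lookup⇒[]= x p (trans eq (Vecₚ.[]=⇒lookup y∈q)))

lookup-∈ : ∀ {p : Subset m} {q : Subset n} {x y} → x ∈ p ⇔ y ∈ q → lookup p x ≡ lookup q y
lookup-∈ {p = p} {q} {x} {y} equiv with lookup p x in eq | lookup q y in eq′
... | true  | true  = refl
... | false | false = refl
... | true  | false = contradiction
  (trans (sym eq′) (Vecₚ.[]=⇒lookup (Equivalence.to equiv (Vecₚ.lookup⇒[]= x p eq)))) λ ()
... | false | true  = contradiction
  (trans (sym eq) (Vecₚ.[]=⇒lookup (Equivalence.from equiv (Vecₚ.lookup⇒[]= y q eq′)))) λ ()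

-- For finitely many indices the double negations can be removed one after another. The counting
-- argument needs minimum cuts for all blocks at once.
¬¬-finite-choice : ∀ {P : Fin m → Set} → (∀ i → ¬ ¬ P i) → ¬ ¬ (∀ i → P i)
¬¬-finite-choice {zero}  ¬¬P ¬all = ¬all λ ()
¬¬-finite-choice {suc m} ¬¬P ¬all = ¬¬P zero λ p₀ → ¬¬-finite-choice (¬¬P ∘ suc) λ ps →
  ¬all λ { zero → p₀ ; (suc i) → ps i }

module BlockCuts (n b′ : ℕ) (0<n : 0 ℕ.< n) (r : Fin 4) where
  open GenericCosts n b′
  open GridNetwork n b′ 0<n r

  incidence : Subset (size ℕ.* size) → Fin size → Fin size → Bool
  incidence W p q = lookup W (vertex p q)

  cutCost-gridCut : ∀ W → cutCost network W ≈ fromℕ (gridCut (incidence W))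
  cutCost-gridCut W = subst (λ x → cutCost network W ≈ fromℕ x) (sum-segment cutTerm)
    (≈-trans {cutCost network W} {sum (fromℕ ∘ cutTerm ∘ segment)} {fromℕ (sumℕ (cutTerm ∘ segment))}
      (sum-if-fromℕ (λ i → lookup W (source (segment i)) xor lookup W (target (segment i)))
                    (segmentCost ∘ segment))
      (sum-fromℕ (cutTerm ∘ segment)))
    where
    cutTerm : Segment → ℕ
    cutTerm s = if lookup W (source s) xor lookup W (target s) then segmentCost s else 0
    sum-if-fromℕ : ∀ {m} (c : Fin m → Bool) (f : Fin m → ℕ) →
      sum (λ i → if c i then fromℕ (f i) else 0ℝ) ≈ sum (λ i → fromℕ (if c i then f i else 0))
    sum-if-fromℕ {zero}  c f = ≈-refl {0ℝ}
    sum-if-fromℕ {suc m} c f = +-cong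
      {if c zero then fromℕ (f zero) else 0ℝ} {fromℕ (if c zero then f zero else 0)}
      {sum (λ i → if c (suc i) then fromℕ (f (suc i)) else 0ℝ)}
      {sum (λ i → fromℕ (if c (suc i) then f (suc i) else 0))}
      (first (c zero)) (sum-if-fromℕ (c ∘ suc) (f ∘ suc))
      where
      first : ∀ x → (if x then fromℕ (f zero) else 0ℝ) ≈ fromℕ (if x then f zero else 0)
      first true  = ≈-refl {fromℕ (f zero)}
      first false = ≈-refl {0ℝ}

  -- Comparing through `xor` instead of label by label also covers the passage to the complement.
  gridCut-cong : ∀ (w w′ : Fin size → Fin size → Bool) →
    (∀ p q p′ q′ → w p q xor w p′ q′ ≡ w′ p q xor w′ p′ q′) → gridCut w ≡ gridCut w′
  gridCut-cong w w′ eq = cong₂ ℕ._+_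
    (sum-cong-≗ {n} λ p → sum-cong-≗ {1 ℕ.+ n} λ e →
      cong (λ x → if x then kʰ p e else 0) (eq (mid p) (inject₁ e) (mid p) (suc e)))
    (sum-cong-≗ {n} λ q → sum-cong-≗ {1 ℕ.+ n} λ e →
      cong (λ x → if x then kᵛ q e else 0) (eq (inject₁ e) (mid q) (suc e) (mid q)))

  module _ (I J : Fin n) where

    blockSet : Subset (size ℕ.* size)
    blockSet = tabulate (uncurry (block I J) ∘ coordinates)

    lookup-blockSet : ∀ p q → lookup blockSet (vertex p q) ≡ block I J p q
    lookup-blockSet p q = trans (Vecₚ.lookup∘tabulate (uncurry (block I J) ∘ coordinates) (vertex p q))
      (cong (uncurry (block I J)) (coordinates-vertex p q))

    blockTerminals : Subset k
    blockTerminals = tabulate λ i → lookup blockSet (terminal i)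

    lookup-blockTerminals : ∀ i → lookup blockTerminals i ≡ lookup blockSet (terminal i)
    lookup-blockTerminals = Vecₚ.lookup∘tabulate _

    blockSet-separates : Separates network blockTerminals blockSet
    blockSet-separates = inj₁ λ i → ∈-lookup {p = blockSet} {q = blockTerminals} (sym (lookup-blockTerminals i))

    lookup-lineEnd : ∀ s l → ∃[ i ] lookup blockTerminals i ≡ lookup blockSet (lineEnd s l)
    lookup-lineEnd s l = let i , eq = lineEnd-terminal s l in
      i , trans (lookup-blockTerminals i) (cong (lookup blockSet) eq)

    -- The line closest to the corner, which meets every block. Horizontally, its left end lies in
    -- the block; vertically, its bottom end does not.
    l₀ : Fin n
    l₀ = Fin.fromℕ< 0<n

    l₀≼ : (l₀ ≼ I) ≡ true
    l₀≼ = go 0<n I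
      where
      go : ∀ {n m} (0<n : 0 ℕ.< n) (i : Fin m) → (Fin.fromℕ< 0<n ≼ i) ≡ true
      go (s≤s z≤n) i = refl

    blockTerminals≢⊥ : blockTerminals ≢ ⊥
    blockTerminals≢⊥ eq = let i , eq-i = lookup-lineEnd (zero , zero) l₀ in contradiction
      (trans (sym (trans eq-i (trans (lookup-blockSet (mid l₀) zero)
        (trans (Boolₚ.∧-identityʳ _) (trans (inject₁-≼ l₀ I) l₀≼)))))
        (trans (cong (λ S → lookup S i) eq) (Vecₚ.lookup-replicate i outside))) λ ()

    blockTerminals≢⊤ : blockTerminals ≢ ⊤
    blockTerminals≢⊤ eq = let i , eq-i = lookup-lineEnd (suc zero , suc zero) l₀ in contradiction
      (trans (sym (trans eq-i (trans (lookup-blockSet last (mid l₀)) (cong (_∧ (mid l₀ ≼ suc J)) (fromℕ⋠ I)))))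
        (trans (cong (λ S → lookup S i) eq) (Vecₚ.lookup-replicate i inside))) λ ()

    agree-minimal : ∀ w → (∀ i p q → terminal i ≡ vertex p q → w p q ≡ lookup blockTerminals i) →
                    blockValue I J ℕ.≤ gridCut w
    agree-minimal w agree = block-minimal I J w
      (λ l → at (zero , zero) l (mid l) zero refl) (λ l → at (zero , suc zero) l (mid l) last refl)
      (λ l → at (suc zero , zero) l zero (mid l) refl) (λ l → at (suc zero , suc zero) l last (mid l) refl)
      where
      at : ∀ s l p q → lineEnd s l ≡ vertex p q → w p q ≡ block I J p q
      at s l p q eq = let i , eq-i = lineEnd-terminal s l in
        trans (agree i p q (trans eq-i eq)) (trans (lookup-blockTerminals i)
          (trans (cong (lookup blockSet) (trans eq-i eq)) (lookup-blockSet p q)))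

    separating-minimal : ∀ W → Separates network blockTerminals W → blockValue I J ℕ.≤ gridCut (incidence W)
    separating-minimal W (inj₁ same) = agree-minimal (incidence W) λ i p q eq →
      trans (cong (lookup W) (sym eq)) (lookup-∈ {p = W} {q = blockTerminals} (same i))
    -- Here `W` is the side of the cut away from the block's terminals; exchanging the sides cuts
    -- the same edges.
    separating-minimal W (inj₂ opposed) = ℕₚ.≤-trans
      (agree-minimal (λ p q → not (incidence W p q)) λ i p q eq → trans
        (cong not (trans (cong (lookup W) (sym eq)) (trans (lookup-∈ {p = W} {q = ∁ blockTerminals} (opposed i))
          (Vecₚ.lookup-map i not blockTerminals))))
        (Boolₚ.not-involutive _))
      (ℕₚ.≤-reflexive (gridCut-cong (λ p q → not (incidence W p q)) (incidence W) λ p q p′ q′ →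
        Boolₚ.xor-annihilates-not (incidence W p q) (incidence W p′ q′)))

    cutCost-blockSet : cutCost network blockSet ≈ fromℕ (blockValue I J)
    cutCost-blockSet = subst (λ x → cutCost network blockSet ≈ fromℕ x)
      (trans (gridCut-cong (incidence blockSet) (block I J) λ p q p′ q′ →
               cong₂ _xor_ (lookup-blockSet p q) (lookup-blockSet p′ q′))
             (gridCut-block I J))
      (cutCost-gridCut blockSet)

    -- As a lower bound, `v` is at most the cost of the block. The converse needs a cut that attains
    -- `v`, which exists only under a double negation.
    mincut-value : ∀ v → IsMincut network blockTerminals v → ¬ ¬ (v ≈ fromℕ (blockValue I J))
    mincut-value v (lower , attained) ¬eq = attained λ (W , separates , cost≈v) → ¬eq (≤-antisym {v} {value}
      (≤-trans {v} {cutCost network blockSet} {value}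
        (lower blockSet blockSet-separates) (≈⇒≤ {cutCost network blockSet} {value} cutCost-blockSet))
      (≤-trans {value} {fromℕ (gridCut (incidence W))} {v} (fromℕ-mono-≤ (separating-minimal W separates))
        (≤-trans {fromℕ (gridCut (incidence W))} {cutCost network W} {v}
          (≈⇒≥ {cutCost network W} {fromℕ (gridCut (incidence W))} (cutCost-gridCut W))
          (≈⇒≤ {cutCost network W} {v} cost≈v))))
      where value = fromℕ (blockValue I J)

    -- What passes on to the counting argument is a set of edges of `N′` whose costs add up to the
    -- block value.
    mimicking-cut : ∀ (N′ : Network k) → IsMimicking N′ network →
                    ¬ ¬ (∃[ W ] cutCost N′ W ≈ fromℕ (blockValue I J))
    mimicking-cut N′ mimicking ¬cut =
      let v , (_ , attained′) , mincut = mimicking blockTerminals blockTerminals≢⊥ blockTerminals≢⊤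
      in  mincut-value v mincut λ v≈value → attained′ λ (W , _ , cost≈v) →
            ¬cut (W , ≈-trans {cutCost N′ W} {v} {fromℕ (blockValue I J)} cost≈v v≈value)

-- Counting the edges of a mimicking network

module EdgeBound (n : ℕ) (0<n : 0 ℕ.< n) (r : Fin 4) where
  -- For `s = n * n` values the base is `b = s ^ s + 1`. In the pigeonhole count
  -- `(s * b) ^ m < b ^ s` with `m < s`, the spare factor `b` on the right must outweigh `s ^ m`.
  open GenericCosts n ((n ℕ.* n) ^ (n ℕ.* n))
  open GridNetwork n ((n ℕ.* n) ^ (n ℕ.* n)) 0<n r
  open BlockCuts n ((n ℕ.* n) ^ (n ℕ.* n)) 0<n r

  -- Block number `opposite t`, so that its power of `b` has the weight of digit `t` in `funToFin`.
  row column : Fin (n ℕ.* n) → Fin n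
  row    t = proj₁ (remQuot {n} n (opposite t))
  column t = proj₂ (remQuot {n} n (opposite t))

  mimicking-edges : ∀ (N′ : Network k) → IsMimicking N′ network → n ℕ.* n ℕ.≤ Network.∣E∣ N′
  -- The bound is a decidable statement about natural numbers, so it may be proved under a double
  -- negation, where the cuts are available.
  mimicking-edges N′ mimicking = decidable-stable (n ℕ.* n ℕₚ.≤? ∣E∣) λ ¬bound →
    ¬¬-finite-choice {n ℕ.* n} (λ t → mimicking-cut (row t) (column t) N′ mimicking) λ cuts → ¬bound
      (few-subset-sums fromℕ (≈-refl {0ℝ}) fromℕ-+ {n ℕ.* n} {∣E∣} {b} {A}
        (λ t → blockValue (row t) (column t)) (λ t → multiplicity (row t) (column t))
        fromℕ-injective (ℕₚ.n<1+n _) D≤A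
        (λ t → trans (cong (λ i → b ^ toℕ i ℕ.+ blockValue (row t) (column t))
                           (sym (Finₚ.combine-remQuot {n} n (opposite t))))
                     (blockValue-digit (row t) (column t)))
        cost (λ t e → lookup (proj₁ (cuts t)) (proj₁ (ends e)) xor lookup (proj₁ (cuts t)) (proj₂ (ends e)))
        (λ t → proj₂ (cuts t)))
    where open Network N′ using (∣E∣; cost; ends)

-- The constant and the passage to arbitrary `k`

ι-* : ∀ m n → ι (m ℕ.* n) ≡ ι m ℚ.* ι n
ι-* m n rewrite ι-canonical m | ι-canonical n = cong (ℚ._/ 1) (ℤₚ.pos-* m n)

seq-· : ∀ m q i → seq (m · fromℚ q) i ≡ ι m ℚ.* q
seq-· zero    q i = sym (ℚₚ.*-zeroˡ q)
seq-· (suc m) q i = begin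
  q ℚ.+ seq (m · fromℚ q) i ≡⟨ cong (q ℚ.+_) (seq-· m q i) ⟩
  q ℚ.+ ι m ℚ.* q           ≡⟨ cong (ℚ._+ ι m ℚ.* q) (ℚₚ.*-identityˡ q) ⟨
  1ℚ ℚ.* q ℚ.+ ι m ℚ.* q    ≡⟨ ℚₚ.*-distribʳ-+ q 1ℚ (ι m) ⟨
  (1ℚ ℚ.+ ι m) ℚ.* q        ≡⟨ cong (ℚ._* q) (ι-+ 1 m) ⟨
  ι (suc m) ℚ.* q           ∎
  where open ≡-Reasoning

-- For `k = r + 4 n` with `r < 4 ≤ 4 n` we get `k ≤ 8 n`, so `n * n` edges are at least
-- `k ^ 2 / 64`.
β : ℚ
β = ℤ.+ 1 ℚ./ 64

·β-≤ : ∀ m n → m ℕ.≤ n ℕ.* 64 → m · fromℚ β ≤ fromℕ n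
·β-≤ m n m≤64n = pointwise⇒≤ {m · fromℚ β} {fromℕ n} λ i → begin
  seq (m · fromℚ β) i   ≡⟨ seq-· m β i ⟩
  ι m ℚ.* β             ≤⟨ ℚₚ.*-monoʳ-≤-nonNeg β (ι-mono-≤ m≤64n) ⟩
  ι (n ℕ.* 64) ℚ.* β    ≡⟨ cong (ℚ._* β) (ι-* n 64) ⟩
  ι n ℚ.* ι 64 ℚ.* β    ≡⟨ ℚₚ.*-assoc (ι n) (ι 64) β ⟩
  ι n ℚ.* 1ℚ            ≡⟨ ℚₚ.*-identityʳ (ι n) ⟩
  ι n                   ∎
  where open ℚₚ.≤-Reasoning

quarter-positive : ∀ (r : Fin 4) n → toℕ r ℕ.+ n ℕ.* 4 > 5 → 0 ℕ.< n
quarter-positive r zero    k>5 = contradiction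
  (ℕₚ.≤-trans k>5 (ℕₚ.≤-trans (ℕₚ.≤-reflexive (ℕₚ.+-identityʳ (toℕ r))) (Finₚ.toℕ≤pred[n] r)))
  λ { (s≤s (s≤s (s≤s ()))) }
quarter-positive r (suc n) k>5 = s≤s z≤n

square-bound : ∀ (r : Fin 4) {n} → 0 ℕ.< n → (toℕ r ℕ.+ n ℕ.* 4) ^ 2 ℕ.≤ n ℕ.* n ℕ.* 64
square-bound r {n} 0<n = begin
  k ^ 2                     ≤⟨ ℕₚ.^-monoˡ-≤ 2 k≤8n ⟩
  (n ℕ.* 4 ℕ.+ n ℕ.* 4) ^ 2 ≡⟨ solve 1 (λ n → (n :* con 4 :+ n :* con 4) :^ 2 := n :* n :* con 64) refl n ⟩
  n ℕ.* n ℕ.* 64            ∎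
  where
  open ℕₚ.≤-Reasoning
  open +-*-Solver
  k = toℕ r ℕ.+ n ℕ.* 4
  k≤8n : k ℕ.≤ n ℕ.* 4 ℕ.+ n ℕ.* 4
  k≤8n = ℕₚ.+-monoˡ-≤ (n ℕ.* 4) (ℕₚ.≤-trans (ℕₚ.<⇒≤ (Finₚ.toℕ<n r)) (ℕₚ.*-monoˡ-≤ 4 0<n))

QuadraticBound : ℕ → Set
QuadraticBound k = ∃[ N ] Planar (Network.graph {k} N) ×
  (∀ (N′ : Network k) → IsMimicking N′ N → (k ^ 2) · fromℚ β ≤ fromℕ (Network.∣E∣ N′))

quadratic-bound : ∀ (r : Fin 4) n → 0 ℕ.< n → QuadraticBound (toℕ r ℕ.+ n ℕ.* 4)
quadratic-bound r n 0<n =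
  GridNetwork.network n _ 0<n r , GridNetwork.planar n _ 0<n r , λ N′ mimicking →
    ·β-≤ ((toℕ r ℕ.+ n ℕ.* 4) ^ 2) (Network.∣E∣ N′) (ℕₚ.≤-trans (square-bound r 0<n)
      (ℕₚ.*-monoˡ-≤ 64 (EdgeBound.mimicking-edges n 0<n r N′ mimicking)))

theorem1p3 : ∃[ β ] 0ℝ < β ×
    (∀ (k : ℕ) → k > 5 →
    ∃[ N ] Planar (Network.graph {k} N) ×
    (∀ (N′ : Network k) → IsMimicking N′ N →
    (k ^ 2) · β ≤ fromℕ (Network.∣E∣ N′)))
theorem1p3 = fromℚ β , (β , ℚₚ.positive⁻¹ β , 0 , λ _ _ → ℚₚ.≤-reflexive (ℚₚ.+-identityˡ β)) , λ k k>5 →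
  let result n r k≡r+4n = k divMod 4
  in  subst QuadraticBound (sym k≡r+4n) (quadratic-bound r n (quarter-positive r n (subst (_> 5) k≡r+4n k>5)))
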